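{- The model checking problem for succinctly encoded formulas of $\mathsf{A\overline{A}B\overline{B}\,\overline{E}}$ over finite Kripke structures is NEXP-hard (under polynomial-time reductions).
   Context: A finite Kripke structure is a tuple $\mathcal{K}=(AP,W,\delta,\mu,w_0)$ with $AP$ a finite set of proposition letters, $W$ a finite set of states, $\delta\subseteq W\times W$ a left-total relation, $\mu:W\to 2^{AP}$ a labelling function, and $w_0\in W$ the initial state. A track over $\mathcal{K}$ is a finite sequence $\rho=v_0\cdots v_n$ of states with $n\ge 1$ and $(v_i,v_{i+1})\in\delta$ for all $0\le i<n$; $\mathrm{Trk}_{\mathcal{K}}$ is the set of all tracks; $|\rho|=n+1$, $\mathrm{fst}(\rho)=v_0$, $\mathrm{lst}(\rho)=v_n$, $\mathrm{states}(\rho)=\{v_0,\dots,v_n\}$, $\rho(i,j)=v_i\cdots v_j$, $\mathrm{Pref}(\rho)=\{\rho(0,i)\mid 1\le i\le|\rho|-2\}$ (proper prefixes of length at least 2) and $\mathrm{Suff}(\rho)=\{\rho(i,|\rho|-1)\mid 1\le i\le|\rho|-2\}$. A track is initial if $\mathrm{fst}(\rho)=w_0$. Formulas of $\mathsf{A\overline{A}B\overline{B}\,\overline{E}}$ over $AP$ are built from proposition letters with $\neg$, $\wedge$ and the unary modalities $\langle X\rangle$, $X\in\{A,\overline{A},B,\overline{B},\overline{E}\}$ (with $\top,\bot,\vee,\to$ and $[X]\psi=\neg\langle X\rangle\neg\psi$ as abbreviations). Semantics over tracks: $\mathcal{K},\rho\models p$ iff $p\in\mu(w)$ for all $w\in\mathrm{states}(\rho)$;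 Boolean connectives as usual; $\mathcal{K},\rho\models\langle X\rangle\psi$ iff there is $\rho'\in\mathrm{Trk}_{\mathcal{K}}$ with $\mathcal{K},\rho'\models\psi$ and: $\mathrm{lst}(\rho)=\mathrm{fst}(\rho')$ for $X=A$; $\mathrm{lst}(\rho')=\mathrm{fst}(\rho)$ for $X=\overline{A}$; $\rho'\in\mathrm{Pref}(\rho)$ for $X=B$; $\rho\in\mathrm{Pref}(\rho')$ for $X=\overline{B}$; $\rho\in\mathrm{Suff}(\rho')$ for $X=\overline{E}$. $\mathcal{K}\models\psi$ iff $\mathcal{K},\rho\models\psi$ for all initial tracks $\rho$. Succinct encoding: formulas may use the shorthands $\langle X\rangle^k\psi$ and $[X]^k\psi$, standing for $k$ repetitions of the modality before $\psi$, with $k$ written in binary; and $\bigwedge_{i=l,\dots,r}\psi(i)$, with $l,r$ naturals written in binary, for a conjunction of formulas in which the index $i$ may occur in the exponents of modalities (exponents may be expressions such as $c\cdot i+d$ with $c,d$ integer constants written in binary). The size of a succinctly encoded formula is the size of this encoding; its meaning is that of the formula obtained by expanding all shorthands. The model checking problem for succinctly encoded formulas is: given a finite Kripke structure $\mathcal{K}$ and a succinctly encoded formula $\psi$ of the fragment, decide whether $\mathcal{K}\models\psi$. -}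

module Defs where

open import Data.Bool.Base using (Bool; true; false; T)
open import Data.Fin.Base using (Fin; toℕ)
open import Data.Fin.Subset using (Subset; _∈_; Nonempty)
open import Data.Integer.Base as ℤ using (ℤ; +_; ∣_∣; _◃_)
open import Data.List.Base as List using (List; []; _∷_; _++_; _ʳ++_)
import Data.List.Membership.Propositional as List
open import Data.List.Relation.Unary.All using (All)
open import Data.List.Relation.Unary.Linked using (Linked)
open import Data.Maybe.Base as Maybe using (Maybe; just; nothing)
open import Data.Nat.Base using (ℕ; zero; suc; _+_; _*_; _^_; _∸_; _≤_)
open import Data.Nat.Binary.Base using (ℕᵇ; zero; 2[1+_]; 1+[2_]; fromℕ)
  renaming (toℕ to val)
open import Data.Nat.GeneralisedArithmetic using (fold)
open import Data.Product.Base using (Σ-syntax; ∃-syntax; _×_; _,_; proj₁; proj₂)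
open import Data.Sign.Base using (Sign)
open import Data.Unit.Base using (⊤)
open import Data.Vec.Base as Vec using (Vec; []; _∷_)
open import Function.Bundles using (_↔_; _⇔_)
open import Relation.Binary.Core using (Rel)
open import Relation.Binary.PropositionalEquality.Core using (_≡_)
open import Relation.Nullary.Negation.Core using (¬_)
open import Level using (0ℓ)

------------------------------------------------------------------------
-- Turing machines

Word : Set
Word = List Bool

Finite : Set → Set
Finite A = ∃[ n ] (A ↔ Fin n)

data Move : Set where
  left stay right : Move

data Symbol (W : Set) : Set where
  blank : Symbol W
  bit   : Bool → Symbol W
  work  : W → Symbol W

-- A two-way infinite tape.  Both lists are ordered outwards from the
-- head; every cell beyond their ends is blank.
record Tape (W : Set) : Set where
  constructor tape
  field
    before : List (Symbol W)
    cell   : Symbol W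
    after  : List (Symbol W)

open Tape public

module _ {W : Set} where

  blankTape : Tape W
  blankTape = tape [] blank []

  inputTape : Word → Tape W
  inputTape []       = blankTape
  inputTape (b ∷ bs) = tape [] (bit b) (List.map bit bs)

  write : Symbol W → Tape W → Tape W
  write a (tape ls _ rs) = tape ls a rs

  move : Move → Tape W → Tape W
  move left  (tape []       a rs) = tape [] blank (a ∷ rs)
  move left  (tape (l ∷ ls) a rs) = tape ls l (a ∷ rs)
  move stay  t                    = t
  move right (tape ls a [])       = tape (a ∷ ls) blank []
  move right (tape ls a (r ∷ rs)) = tape (a ∷ ls) r rs

  act : Symbol W × Move → Tape W → Tape W
  act (a , m) t = move m (write a t)

  -- Apart from blanks on both sides, the tape contains exactly w; the
  -- head may be anywhere.
  Holds : Tape W → Word → Set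
  Holds (tape ls a rs) w = ∃[ i ] ∃[ j ]
    ls ʳ++ (a ∷ rs) ≡
      List.replicate i blank ++ List.map bit w ++ List.replicate j blank

data Steps {C : Set} (_⟶_ : Rel C 0ℓ) : ℕ → Rel C 0ℓ where
  done : ∀ {c} → Steps _⟶_ 0 c c
  _◅_  : ∀ {n c c′ c″} → c ⟶ c′ → Steps _⟶_ n c′ c″ → Steps _⟶_ (suc n) c c″

-- Nondeterministic one-tape machines.  The machine halts when δ offers
-- no transition.
record NTM : Set₁ where
  field
    State Work  : Set
    finiteState : Finite State
    finiteWork  : Finite Work
    start       : State
    accepting   : State → Bool
    δ           : State → Symbol Work → List (State × Symbol Work × Move)

  Config : Set
  Config = State × Tape Work

  initial : Word → Config
  initial x = start , inputTape x

  data _⟶_ : Rel Config 0ℓ where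
    step : ∀ {q q′ a t} → (q′ , a) List.∈ δ q (cell t) →
           (q , t) ⟶ (q′ , act a t)

  HaltsWithin : ℕ → Word → Set
  HaltsWithin b x = ∀ {n c} → Steps _⟶_ n (initial x) c → n ≤ b

  Accepts : Word → Set
  Accepts x = ∃[ n ] ∃[ c ]
    Steps _⟶_ n (initial x) c × T (accepting (proj₁ c))

-- Deterministic multi-tape machines computing word functions.
record DTM : Set₁ where
  field
    State Work   : Set
    finiteState  : Finite State
    finiteWork   : Finite Work
    tapes        : ℕ
    input output : Fin tapes
    start        : State
    δ            : State → Vec (Symbol Work) tapes →
                   Maybe (State × Vec (Symbol Work × Move) tapes)

  Config : Set
  Config = State × Vec (Tape Work) tapes

  initial : Word → Config
  initial x = start , (Vec.replicate tapes blankTape Vec.[ input ]≔ inputTape x)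

  next : Config → Maybe Config
  next (q , ts) = Maybe.map (λ (q′ , as) → q′ , Vec.zipWith act as ts)
                            (δ q (Vec.map cell ts))

  _⟶_ : Rel Config 0ℓ
  c ⟶ c′ = next c ≡ just c′

  ComputesWithin : ℕ → Word → Word → Set
  ComputesWithin b x y = ∃[ n ] ∃[ c ]
    n ≤ b × Steps _⟶_ n (initial x) c × next c ≡ nothing ×
    Holds (Vec.lookup (proj₂ c) output) y

------------------------------------------------------------------------
-- Complexity

Language : Set₁
Language = Word → Set

-- NEXP is the union over k of NTIME(O(2^(n^k))).
NEXP : Language → Set₁
NEXP L = ∃[ M ] ∃[ c ] ∃[ k ] let open NTM M in
  (∀ x → HaltsWithin (c * 2 ^ (List.length x ^ k)) x) ×
  (∀ x → L x ⇔ Accepts x)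

PolyTime : (Word → Word) → Set₁
PolyTime f = ∃[ M ] ∃[ c ] ∃[ k ] let open DTM M in
  ∀ x → ComputesWithin (c * List.length x ^ k + c) x (f x)

record Problem : Set₁ where
  field
    Instance : Set
    encode   : Instance → Word
    Yes      : Instance → Set

-- Polynomial-time many-one reducibility.
_≤ₚ_ : Language → Problem → Set₁
L ≤ₚ P = Σ[ r ∈ (Word → Instance) ]
  PolyTime (λ x → encode (r x)) × (∀ x → L x ⇔ Yes (r x))
  where open Problem P

NEXP-hard : Problem → Set₁
NEXP-hard P = ∀ L → NEXP L → L ≤ₚ P

------------------------------------------------------------------------
-- Formulas and their interval semantics

data Modality : Set where
  A Ā B B̄ Ē : Modality

data Formula (m : ℕ) : Set where
  letter : Fin m → Formula m
  ¬′_    : Formula m → Formula m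
  _∧′_   : Formula m → Formula m → Formula m
  ⟨_⟩_   : Modality → Formula m → Formula m

infixr 6 _∧′_
infix  7 ¬′_ ⟨_⟩_ [_]_

[_]_ : ∀ {m} → Modality → Formula m → Formula m
[ X ] ψ = ¬′ ⟨ X ⟩ ¬′ ψ

-- δ v is the set of successors of v.
record Kripke : Set where
  field
    letters states : ℕ
    δ              : Fin states → Subset states
    left-total     : ∀ v → Nonempty (δ v)
    μ              : Fin states → Subset letters
    w₀             : Fin states

-- segment i j (v₀ ⋯ vₙ) is vᵢ ⋯ vⱼ.
segment : {V : Set} → ℕ → ℕ → List V → List V
segment i j ρ = List.take (suc j ∸ i) (List.drop i ρ)

module _ (K : Kripke) where
  open Kripke K

  record Track : Set where
    field
      path   : List (Fin states)
      long   : 2 ≤ List.length path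
      linked : Linked (λ v w → w ∈ δ v) path

    fst lst : Maybe (Fin states)
    fst = List.head path
    lst = List.last path

  open Track

  Pref Suff : Track → Track → Set
  Pref ρ ρ′ = ∃[ i ] 1 ≤ i × i ≤ List.length (path ρ) ∸ 2 ×
              path ρ′ ≡ segment 0 i (path ρ)
  Suff ρ ρ′ = ∃[ i ] 1 ≤ i × i ≤ List.length (path ρ) ∸ 2 ×
              path ρ′ ≡ segment i (List.length (path ρ) ∸ 1) (path ρ)

  Related : Modality → Rel Track 0ℓ
  Related A ρ ρ′ = lst ρ ≡ fst ρ′
  Related Ā ρ ρ′ = lst ρ′ ≡ fst ρ
  Related B ρ ρ′ = Pref ρ ρ′
  Related B̄ ρ ρ′ = Pref ρ′ ρ
  Related Ē ρ ρ′ = Suff ρ′ ρ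

  Sat : Track → Formula letters → Set
  Sat ρ (letter p)  = All (λ w → p ∈ μ w) (path ρ)
  Sat ρ (¬′ ψ)      = ¬ Sat ρ ψ
  Sat ρ (φ ∧′ ψ)    = Sat ρ φ × Sat ρ ψ
  Sat ρ (⟨ X ⟩ ψ)   = ∃[ ρ′ ] Related X ρ ρ′ × Sat ρ′ ψ

  Models : Formula letters → Set
  Models ψ = ∀ ρ → fst ρ ≡ just w₀ → Sat ρ ψ

------------------------------------------------------------------------
-- Succinctly encoded formulas

-- n is the number of conjunction indices in scope, referred to by de
-- Bruijn index.  Integer constants are a sign and a binary magnitude.
data Exponent (n : ℕ) : Set where
  const  : ℕᵇ → Exponent n
  affine : (c : Sign × ℕᵇ) (i : Fin n) (d : Sign × ℕᵇ) → Exponent n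

data Succinct (m n : ℕ) : Set where
  letter : Fin m → Succinct m n
  ¬′_    : Succinct m n → Succinct m n
  _∧′_   : Succinct m n → Succinct m n → Succinct m n
  ⟨_⟩^   : Modality → Exponent n → Succinct m n → Succinct m n
  [_]^   : Modality → Exponent n → Succinct m n → Succinct m n
  ⋀      : (l r : ℕᵇ) → Succinct m (suc n) → Succinct m n

valℤ : Sign × ℕᵇ → ℤ
valℤ (s , k) = s ◃ val k

exponent : ∀ {n} → Vec ℕ n → Exponent n → ℤ
exponent η (const k)      = + val k
exponent η (affine c i d) = valℤ c ℤ.* + Vec.lookup η i ℤ.+ valℤ d

-- No exponent ever evaluates to a negative number and no conjunction
-- is empty.
Valid : ∀ {m n} → Vec ℕ n → Succinct m n → Set
Valid η (letter p)     = ⊤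
Valid η (¬′ ψ)         = Valid η ψ
Valid η (φ ∧′ ψ)       = Valid η φ × Valid η ψ
Valid η (⟨ X ⟩^ e ψ)   = + 0 ℤ.≤ exponent η e × Valid η ψ
Valid η ([ X ]^ e ψ)   = + 0 ℤ.≤ exponent η e × Valid η ψ
Valid η (⋀ l r ψ)      = val l ≤ val r ×
                         (∀ i → val l ≤ i → i ≤ val r → Valid (i ∷ η) ψ)

-- f l ∧ f (l + 1) ∧ ⋯ ∧ f (l + k)
conjunction : ∀ {m} → (ℕ → Formula m) → (l k : ℕ) → Formula m
conjunction f l zero    = f l
conjunction f l (suc k) = f l ∧′ conjunction f (suc l) k

-- Meaningful for valid formulas: ∣_∣ and _∸_ are then exact.
expand : ∀ {m n} → Vec ℕ n → Succinct m n → Formula m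
expand η (letter p)   = letter p
expand η (¬′ ψ)       = ¬′ expand η ψ
expand η (φ ∧′ ψ)     = expand η φ ∧′ expand η ψ
expand η (⟨ X ⟩^ e ψ) = fold (expand η ψ) ⟨ X ⟩_ ∣ exponent η e ∣
expand η ([ X ]^ e ψ) = fold (expand η ψ) [ X ]_ ∣ exponent η e ∣
expand η (⋀ l r ψ)    =
  conjunction (λ i → expand (i ∷ η) ψ) (val l) (val r ∸ val l)

------------------------------------------------------------------------
-- Binary encodings; every one of them is a prefix code

encodeℕᵇ : ℕᵇ → Word
encodeℕᵇ zero     = false ∷ []
encodeℕᵇ 2[1+ k ] = true ∷ true ∷ encodeℕᵇ k
encodeℕᵇ 1+[2 k ] = true ∷ false ∷ encodeℕᵇ k

encodeℕ : ℕ → Word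
encodeℕ k = encodeℕᵇ (fromℕ k)

encodeFin : ∀ {n} → Fin n → Word
encodeFin i = encodeℕ (toℕ i)

encodeSigned : Sign × ℕᵇ → Word
encodeSigned (Sign.+ , k) = true  ∷ encodeℕᵇ k
encodeSigned (Sign.- , k) = false ∷ encodeℕᵇ k

encodeModality : Modality → Word
encodeModality A = false ∷ false ∷ false ∷ []
encodeModality Ā = false ∷ false ∷ true  ∷ []
encodeModality B = false ∷ true  ∷ false ∷ []
encodeModality B̄ = false ∷ true  ∷ true  ∷ []
encodeModality Ē = true  ∷ false ∷ false ∷ []

encodeExponent : ∀ {n} → Exponent n → Word
encodeExponent (const k)      = false ∷ encodeℕᵇ k
encodeExponent (affine c i d) =
  true ∷ encodeSigned c ++ encodeFin i ++ encodeSigned d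

encodeSuccinct : ∀ {m n} → Succinct m n → Word
encodeSuccinct (letter p)   = false ∷ false ∷ false ∷ encodeFin p
encodeSuccinct (¬′ ψ)       = false ∷ false ∷ true  ∷ encodeSuccinct ψ
encodeSuccinct (φ ∧′ ψ)     =
  false ∷ true ∷ false ∷ encodeSuccinct φ ++ encodeSuccinct ψ
encodeSuccinct (⟨ X ⟩^ e ψ) =
  false ∷ true ∷ true ∷ encodeModality X ++ encodeExponent e ++ encodeSuccinct ψ
encodeSuccinct ([ X ]^ e ψ) =
  true ∷ false ∷ false ∷ encodeModality X ++ encodeExponent e ++ encodeSuccinct ψ
encodeSuccinct (⋀ l r ψ)    =
  true ∷ false ∷ true ∷ encodeℕᵇ l ++ encodeℕᵇ r ++ encodeSuccinct ψ

-- The two tables are written row by row, one bit per entry.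
encodeKripke : Kripke → Word
encodeKripke K =
  encodeℕ letters ++ encodeℕ states ++ table δ ++ table μ ++ encodeFin w₀
  where
  open Kripke K
  table : ∀ {k} → (Fin states → Vec Bool k) → Word
  table f = List.concat (List.tabulate (λ v → Vec.toList (f v)))

------------------------------------------------------------------------
-- The model checking problem

record MCInstance : Set where
  field
    kripke  : Kripke
    formula : Succinct (Kripke.letters kripke) 0
    valid   : Valid [] formula

SuccinctModelChecking : Problem
SuccinctModelChecking = record
  { Instance = MCInstance
  ; encode   = λ I → let open MCInstance I in
                 encodeKripke kripke ++ encodeSuccinct formula
  ; Yes      = λ I → let open MCInstance I in
                 Models kripke (expand [] formula)
  }

{-# OPTIONS --safe #-}
-- The track to be guessed is a tableau of an accepting computation,
-- written row by row into a single sequence of cells over a complete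
-- Kripke structure whose states are the possible cells.  On such a track
-- ⟨B⟩ᵏ⊤ says that the index is at least k, and ⟨A⟩ with a letter reads
-- the last cell.  With exponents in binary these two express "the cell at
-- index e is a" for exponentially large e, and a succinct conjunction over
-- t compares the cells t, t + 1, t + 2 and t + 1 + N, where N is the
-- length of a row: every window of the tableau is checked.  The input is
-- spelled by a chain of nested ⟨B⟩, forced to be tight by the number of
-- indices it may use.  All numbers have the form 2 · Pʲ with P a power
-- of 2, so their encodings repeat one block |x|^(k+1) times, up to
-- constants, and nested loops over the input print the formula.

module Submission where

open import Defs
open import Data.Bool.Base using (Bool; true; false; T; if_then_else_)
open import Data.Bool.Properties using (T-≡; T?)
open import Data.Empty using (⊥)
open import Data.Fin.Base using (Fin; zero; suc)
import Data.Fin.Properties as Fin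
open import Data.Fin.Subset as Subset using (⁅_⁆)
open import Data.Fin.Subset.Properties using (∈⊤; x∈⁅x⁆; x∈⁅y⁆⇒x≡y)
open import Data.Integer.Base as ℤ using (∣_∣)
import Data.Integer.Properties as ℤ
open import Data.List.Base as List
  using (List; []; _∷_; _++_; _ʳ++_; concatMap; length; reverse; applyUpTo)
import Data.List.Membership.DecPropositional as DecMembership
open import Data.List.Membership.Propositional using (_∈_)
import Data.List.Properties as List
open import Data.List.Relation.Unary.All using (All; []; _∷_)
open import Data.List.Relation.Unary.Any using (here; there)
open import Data.List.Relation.Unary.Linked using (Linked; []; [-]; _∷_)
open import Data.Maybe.Base as Maybe using (Maybe; just; nothing; _<∣>_; maybe′)
open import Data.Nat.Base
open import Data.Nat.Binary.Base using (ℕᵇ; zero; 2[1+_]; 1+[2_]) renaming (toℕ to val)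
open import Data.Nat.Divisibility using (n∣m*n)
open import Data.Nat.DivMod using (_/_; m*n/n≡m; m<n⇒m/n≡0; +-distrib-/-∣ˡ)
open import Data.Nat.GeneralisedArithmetic using (fold)
open import Data.Nat.Properties
open import Data.Nat.Tactic.RingSolver using (solve-∀)
open import Data.Product.Base using (Σ; Σ-syntax; ∃-syntax; _×_; _,_; proj₁; proj₂; map₁)
open import Data.Product.Function.NonDependent.Propositional using (_×-⇔_; _×-↔_)
open import Data.Sign.Base using (Sign)
open import Data.Sum.Base using (_⊎_; inj₁; inj₂)
open import Data.Sum.Function.Propositional using (_⊎-↔_)
open import Data.Unit.Base using (⊤; tt)
open import Data.Vec.Base as Vec using (Vec; []; _∷_)
import Data.Vec.Properties as Vec
open import Function.Base using (_∘_; id)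
open import Function.Bundles using (_↔_; mk↔ₛ′; _⇔_; mk⇔; Equivalence; Inverse)
open import Function.Construct.Composition using (_↔-∘_)
open import Function.Construct.Identity using (↔-id)
open import Function.Construct.Symmetry using (↔-sym)
open import Function.Properties.Inverse using (↔⇒↣)
open import Relation.Binary.Definitions using (DecidableEquality)
open import Relation.Binary.PropositionalEquality
open import Relation.Nullary.Decidable
  using (Dec; yes; no; via-injection; _×-dec_; ¬?; decidable-stable)
open import Relation.Nullary.Negation.Core using (¬_; contradiction)

open Equivalence using (to; from)

-- Finite types

-- Modelling is universal over initial tracks while acceptance is existential. A leading `⟨ A ⟩`
-- converts one into the other: it replaces the given track by one that is arbitrary except for its
-- first state, and that state is kept outside the tableau.
--
-- Rows carry no end markers, so windows at a border look into the adjacent row. They are tolerated,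
-- which lets a single conjunction index run over all cells without regard to rows. A wrong symbol
-- or head moves at most one cell per row, as does the true head; it is therefore enough to start
-- the head far from both borders and to look for acceptance well inside row `D`. The margins must
-- be easy to print as well as large, so they are powers of `D`. Acceptance is tested in one fixed
-- row, and a waiting action lets every shorter accepting run last until then.

Finite-⊥ : Finite ⊥
Finite-⊥ = 0 , mk↔ₛ′ (λ ()) (λ ()) (λ ()) (λ ())

Finite-⊤ : Finite ⊤
Finite-⊤ = 1 , mk↔ₛ′ (λ _ → zero) (λ _ → tt) (λ { zero → refl }) (λ _ → refl)

Finite-Fin : ∀ n → Finite (Fin n)
Finite-Fin n = n , ↔-id _

Finite-↔ : {X Y : Set} → X ↔ Y → Finite Y → Finite X
Finite-↔ e (n , f) = n , f ↔-∘ e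

Finite-⊎ : {X Y : Set} → Finite X → Finite Y → Finite (X ⊎ Y)
Finite-⊎ (m , f) (n , g) = m + n , ↔-sym Fin.+↔⊎ ↔-∘ (f ⊎-↔ g)

Finite-× : {X Y : Set} → Finite X → Finite Y → Finite (X × Y)
Finite-× (m , f) (n , g) = m * n , ↔-sym Fin.*↔× ↔-∘ (f ×-↔ g)

Finite-ΣBool : {P : Bool → Set} → (∀ b → Finite (P b)) → Finite (Σ Bool P)
Finite-ΣBool fin = Finite-↔
  (mk↔ₛ′ (λ { (false , p) → inj₁ p ; (true , p) → inj₂ p })
         (λ { (inj₁ p) → false , p ; (inj₂ p) → true , p })
         (λ { (inj₁ _) → refl ; (inj₂ _) → refl })
         (λ { (false , _) → refl ; (true , _) → refl }))
  (Finite-⊎ (fin false) (fin true))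

Finite-Bool : Finite Bool
Finite-Bool = Finite-↔
  (mk↔ₛ′ (λ b → b , tt) proj₁ (λ _ → refl) (λ _ → refl))
  (Finite-ΣBool (λ _ → Finite-⊤))

Finite-Maybe : {X : Set} → Finite X → Finite (Maybe X)
Finite-Maybe fin = Finite-↔
  (mk↔ₛ′ (maybe′ inj₂ (inj₁ tt)) (λ { (inj₁ _) → nothing ; (inj₂ x) → just x })
         (λ { (inj₁ _) → refl ; (inj₂ _) → refl })
         (λ { nothing → refl ; (just _) → refl }))
  (Finite-⊎ Finite-⊤ fin)

Finite-Symbol : {W : Set} → Finite W → Finite (Symbol W)
Finite-Symbol fin = Finite-↔
  (mk↔ₛ′ (λ { blank → nothing ; (bit b) → just (inj₁ b) ; (work w) → just (inj₂ w) })
         (λ { nothing → blank ; (just (inj₁ b)) → bit b ; (just (inj₂ w)) → work w })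
         (λ { nothing → refl ; (just (inj₁ _)) → refl ; (just (inj₂ _)) → refl })
         (λ { blank → refl ; (bit _) → refl ; (work _) → refl }))
  (Finite-Maybe (Finite-⊎ Finite-Bool fin))

Finite-Move : Finite Move
Finite-Move = Finite-↔
  (mk↔ₛ′ (λ { left → zero ; stay → suc zero ; right → suc (suc zero) })
         (λ { zero → left ; (suc zero) → stay ; (suc (suc zero)) → right })
         (λ { zero → refl ; (suc zero) → refl ; (suc (suc zero)) → refl })
         (λ { left → refl ; stay → refl ; right → refl }))
  (Finite-Fin 3)

_◅◅_ : {C : Set} {_⟶_ : C → C → Set} {m n : ℕ} {c c′ c″ : C} →
       Steps _⟶_ m c c′ → Steps _⟶_ n c′ c″ → Steps _⟶_ (m + n) c c″
done    ◅◅ ts = ts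
(s ◅ r) ◅◅ ts = s ◅ (r ◅◅ ts)

-- Loop programs

-- The tapes of a Prog d, other than the output tape, are d copies of the
-- input; a loop scans one of them from right to left and leaves the
-- others to its body.
data Prog : ℕ → Set where
  emit : ∀ {d} → Maybe Bool → Prog d
  _⨾_  : ∀ {d} → Prog d → Prog d → Prog d
  loop : ∀ {d} → (Bool → Prog d) → Prog (suc d)

⟦_⟧ : ∀ {d} → Prog d → Word → Word
⟦ emit o ⟧ x = List.fromMaybe o
⟦ p ⨾ q ⟧  x = ⟦ p ⟧ x ++ ⟦ q ⟧ x
⟦ loop f ⟧ x = concatMap (λ b → ⟦ f b ⟧ x) (reverse x)

-- A round costs `enter`, `test` and the body; the sum over both letters dominates either body. The
-- last `n + 3` pays for `enter` and `test` at the left blank and for `n + 1` steps of `rewind`.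
time : ∀ {d} → Prog d → ℕ → ℕ
time (emit _) n = 1
time (p ⨾ q)  n = time p n + time q n
time (loop f) n = n * (2 + (time (f false) n + time (f true) n)) + (n + 3)

Sym : Set
Sym = Symbol ⊥

-- Inside a loop the counter remembers the letter `b` just read, so the body never consults the tape
-- of its loop.
PC : ∀ {d} → Prog d → Set
PC (emit _) = ⊤
PC (p ⨾ q)  = PC p ⊎ PC q
PC (loop f) = Fin 3 ⊎ (Σ[ b ∈ Bool ] PC (f b))

pattern enter  = inj₁ zero
pattern test   = inj₁ (suc zero)
pattern rewind = inj₁ (suc (suc zero))
pattern body b s = inj₂ (b , s)

Finite-PC : ∀ {d} (p : Prog d) → Finite (PC p)
Finite-PC (emit _) = Finite-⊤
Finite-PC (p ⨾ q)  = Finite-⊎ (Finite-PC p) (Finite-PC q)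
Finite-PC (loop f) = Finite-⊎ (Finite-Fin 3) (Finite-ΣBool (λ b → Finite-PC (f b)))

entry : ∀ {d} (p : Prog d) → PC p
entry (emit _) = tt
entry (p ⨾ q)  = inj₁ (entry p)
entry (loop f) = enter

idle : ∀ {d} → Vec Sym d → Vec (Sym × Move) d
idle = Vec.map (_, stay)

-- `nothing` in the first component means that the program ends with this step; the second component
-- is the bit appended to the output, if any.
Outcome : Set → ℕ → Set
Outcome S d = Maybe S × Maybe Bool × Vec (Sym × Move) d

tr : ∀ {d} (p : Prog d) → PC p → Vec Sym d → Outcome (PC p) d
tr (emit o) s        cs = nothing , o , idle cs
tr (p ⨾ q)  (inj₁ s) cs = map₁ (just ∘ maybe′ inj₁ (inj₂ (entry q))) (tr p s cs)
tr (p ⨾ q)  (inj₂ s) cs = map₁ (Maybe.map inj₂) (tr q s cs)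
tr (loop f) enter  (c ∷ cs)     = just test , nothing , (c , left) ∷ idle cs
tr (loop f) test   (bit b ∷ cs) =
  just (body b (entry (f b))) , nothing , (bit b , stay) ∷ idle cs
tr (loop f) test   (c ∷ cs)     = just rewind , nothing , (c , right) ∷ idle cs
tr (loop f) rewind (bit b ∷ cs) = just rewind , nothing , (bit b , right) ∷ idle cs
tr (loop f) rewind (c ∷ cs)     = nothing , nothing , (c , stay) ∷ idle cs
tr (loop f) (body b s) (c ∷ cs) with tr (f b) s cs
... | r , o , as = just (maybe′ (body b) enter r) , o , (c , stay) ∷ as

put : Maybe Bool → Tape ⊥ → Tape ⊥
put nothing  t = t
put (just b) t = act (bit b , right) t

at : List Sym → List Sym → Tape ⊥
at ls []       = tape ls blank []
at ls (c ∷ rs) = tape ls c rs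

move-right : ∀ ls c rs → move right (tape ls c rs) ≡ at (c ∷ ls) rs
move-right ls c []       = refl
move-right ls c (r ∷ rs) = refl

act-move : ∀ {d} m (ts : Vec (Tape ⊥) d) →
           Vec.zipWith act (Vec.map (_, m) (Vec.map cell ts)) ts ≡ Vec.map (move m) ts
act-move m []       = refl
act-move m (t ∷ ts) = cong (move m t ∷_) (act-move m ts)

act-idle : ∀ {d} (ts : Vec (Tape ⊥) d) → Vec.zipWith act (idle (Vec.map cell ts)) ts ≡ ts
act-idle ts = trans (act-move stay ts) (Vec.map-id ts)

written : List Sym → Word → Tape ⊥
written ls w = tape (List.map bit w ʳ++ ls) blank []

-- The blank on the left is put there by the first two steps of the
-- machine, so that a loop leaves its tape exactly as it was.
home : Word → Tape ⊥
home x = tape (List.map bit (reverse x) ++ blank ∷ []) blank []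

home-ʳ++ : ∀ x → tape (List.map bit x ʳ++ (blank ∷ [])) blank [] ≡ home x
home-ʳ++ x = cong (λ l → tape l blank []) (trans (List.ʳ++-defn (List.map bit x))
  (cong (_++ (blank ∷ [])) (sym (List.reverse-map bit x))))

written-++ : ∀ ls v w → written (List.map bit v ʳ++ ls) w ≡ written ls (v ++ w)
written-++ ls v w = cong (λ l → tape l blank [])
  (trans (sym (List.++-ʳ++ (List.map bit v)))
         (cong (_ʳ++ ls) (sym (List.map-++ bit v w))))

-- Running a loop program inside a larger machine

module Execution {C : Set} (next : C → Maybe C) (x : Word) where

  _⟶_ : C → C → Set
  c ⟶ c′ = next c ≡ just c′

  resume : ∀ {S d} → (S → Tape ⊥ → Vec (Tape ⊥) d → C) → (Tape ⊥ → Vec (Tape ⊥) d → C) →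
           Outcome S d → Tape ⊥ → Vec (Tape ⊥) d → C
  resume emb exit (r , o , as) t ts = maybe′ emb exit r (put o t) (Vec.zipWith act as ts)

  -- Continuation style: `emb` and `exit` place a program in the configurations of an arbitrary
  -- surrounding machine. Descending to a subprogram changes only these two maps, so `exec` is an
  -- induction on programs.
  Simulates : ∀ {d} (p : Prog d) → (PC p → Tape ⊥ → Vec (Tape ⊥) d → C) →
              (Tape ⊥ → Vec (Tape ⊥) d → C) → Set
  Simulates p emb exit = ∀ s o ts →
    emb s o ts ⟶ resume emb exit (tr p s (Vec.map cell ts)) o ts

  Reaches : ℕ → C → C → Set
  Reaches b c c′ = ∃[ n ] n ≤ b × Steps _⟶_ n c c′

  reaches-trans : ∀ {b b′ c c′ c″} → Reaches b c c′ → Reaches b′ c′ c″ → Reaches (b + b′) c c″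
  reaches-trans (m , m≤ , r) (n , n≤ , s) = m + n , +-mono-≤ m≤ n≤ , r ◅◅ s

  reaches-step : ∀ {b c c′ c″} → c ⟶ c′ → Reaches b c′ c″ → Reaches (suc b) c c″
  reaches-step s (n , n≤ , r) = suc n , s≤s n≤ , s ◅ r

  reaches-≤ : ∀ {b b′ c c′} → b ≤ b′ → Reaches b c c′ → Reaches b′ c c′
  reaches-≤ b≤ (n , n≤ , r) = n , ≤-trans n≤ b≤ , r

  reaches-≡ : ∀ {b c c′ c″} → c′ ≡ c″ → Reaches b c c′ → Reaches b c c″
  reaches-≡ refl r = r

  n = length x

  homes : ∀ d → Vec (Tape ⊥) d
  homes d = Vec.replicate d (home x)

  -- The input copies are back at `home` whenever a program ends; hence a sequel, or the next round
  -- of a surrounding loop, starts under the same assumption.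
  exec : ∀ {d} (p : Prog d) emb exit → Simulates p emb exit → ∀ ls →
         Reaches (time p n) (emb (entry p) (tape ls blank []) (homes d))
                            (exit (written ls (⟦ p ⟧ x)) (homes d))
  exec {d} (emit o) emb exit sim ls = 1 , ≤-refl , (trans (sim tt _ _)
         (cong just (cong₂ exit (put-fromMaybe o) (act-idle _))) ◅ done)
    where
    put-fromMaybe : ∀ o → put o (tape ls blank []) ≡ written ls (List.fromMaybe o)
    put-fromMaybe nothing  = refl
    put-fromMaybe (just b) = refl
  exec {d} (p ⨾ q) emb exit sim ls = reaches-trans
    (exec p (emb ∘ inj₁) (emb (inj₂ (entry q))) sim₁ ls)
    (reaches-≡ (cong (λ t → exit t (homes d)) (written-++ ls (⟦ p ⟧ x) (⟦ q ⟧ x)))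
      (exec q (emb ∘ inj₂) exit sim₂ (List.map bit (⟦ p ⟧ x) ʳ++ ls)))
    where
    sim₁ : Simulates p (emb ∘ inj₁) (emb (inj₂ (entry q)))
    sim₁ s o ts with tr p s (Vec.map cell ts) | sim (inj₁ s) o ts
    ... | just _  , _ | e = e
    ... | nothing , _ | e = e
    sim₂ : Simulates q (emb ∘ inj₂) exit
    sim₂ s o ts with tr q s (Vec.map cell ts) | sim (inj₂ s) o ts
    ... | just _  , _ | e = e
    ... | nothing , _ | e = e
  exec {suc d} (loop f) emb exit sim ls = reaches-≤ (≤-reflexive timing)
      (reaches-trans (iterate ls (reverse x) blank []) finish)
    where
    bodyTime = 2 + (time (f false) n + time (f true) n)
    out = λ ys → concatMap (λ b → ⟦ f b ⟧ x) ys

    timing : length (reverse x) * bodyTime + 2 + suc n ≡ n * bodyTime + (n + 3)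
    timing = trans (+-assoc (length (reverse x) * bodyTime) 2 (suc n))
      (cong₂ (λ l e → l * bodyTime + e) (List.length-reverse x) (+-comm 3 n))

    bodyTime-≥ : ∀ b → time (f b) n ≤ time (f false) n + time (f true) n
    bodyTime-≥ false = m≤m+n _ _
    bodyTime-≥ true  = m≤n+m _ _

    run : ∀ b t ls → Reaches (time (f b) n) (emb (body b (entry (f b))) (tape ls blank []) (t ∷ homes d))
                          (emb enter (written ls (⟦ f b ⟧ x)) (t ∷ homes d))
    run b t ls = exec (f b) (λ s o ts → emb (body b s) o (t ∷ ts)) (λ o ts → emb enter o (t ∷ ts)) sim′ ls
      where
      sim′ : Simulates (f b) (λ s o ts → emb (body b s) o (t ∷ ts)) (λ o ts → emb enter o (t ∷ ts))
      sim′ s o ts with tr (f b) s (Vec.map cell ts) | sim (body b s) o (t ∷ ts)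
      ... | just _  , _ | e = e
      ... | nothing , _ | e = e

    control : ∀ {s s′ o t t′ m} →
      (∀ cs → tr (loop f) s (cell t ∷ cs) ≡ (just s′ , nothing , (cell t , m) ∷ idle cs)) →
      move m t ≡ t′ → emb s o (t ∷ homes d) ⟶ emb s′ o (t′ ∷ homes d)
    control {s} {s′} {o} {t} e refl = trans (sim s o (t ∷ homes d))
      (cong just (trans (cong (λ r → resume emb exit r o (t ∷ homes d)) (e _))
        (cong (λ ts → emb s′ o (_ ∷ ts)) (act-idle _))))

    -- `ys` is the part of the word still to the left of the head, nearest letter first; the letters
    -- already treated are in `c ∷ rs`. The scan starts on the blank after the word, where `ys` is
    -- `reverse x`.
    iterate : ∀ ls ys c rs →
      Reaches (length ys * bodyTime + 2)
        (emb enter (tape ls blank []) (tape (List.map bit ys ++ blank ∷ []) c rs ∷ homes d))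
        (emb rewind (written ls (out ys))
          (at (blank ∷ []) (List.map bit ys ʳ++ (c ∷ rs)) ∷ homes d))
    iterate ls [] c rs =
      reaches-step (control (λ _ → refl) refl)
        (reaches-step (control (λ _ → refl) refl) (0 , ≤-refl , done))
    iterate ls (y ∷ ys) c rs =
      reaches-≤ (≤-reflexive (sym (+-assoc bodyTime _ 2)))
        (reaches-step (control (λ _ → refl) refl)
          (reaches-step (control (λ _ → refl) refl)
            (reaches-trans (reaches-≤ (bodyTime-≥ y) (run y _ ls))
              (reaches-≡ (cong (λ t → emb rewind t
                                          (at (blank ∷ []) (List.map bit ys ʳ++ (bit y ∷ c ∷ rs)) ∷ homes d))
                               (written-++ ls (⟦ f y ⟧ x) (out ys)))
                (iterate (List.map bit (⟦ f y ⟧ x) ʳ++ ls) ys (bit y) (c ∷ rs))))))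

    back : ∀ {o} ys ls → Reaches (suc (length ys))
      (emb rewind o (at ls (List.map bit ys ++ blank ∷ []) ∷ homes d))
      (exit o (tape (List.map bit ys ʳ++ ls) blank [] ∷ homes d))
    back [] ls = 1 , ≤-refl , (trans (sim rewind _ _)
      (cong (λ ts → just (exit _ (_ ∷ ts))) (act-idle _)) ◅ done)
    back (y ∷ ys) ls = reaches-step (control (λ _ → refl) (move-right _ _ _))
      (back ys (bit y ∷ ls))

    finish : Reaches (suc n)
      (emb rewind (written ls (out (reverse x)))
        (at (blank ∷ []) (List.map bit (reverse x) ʳ++ (blank ∷ [])) ∷ homes d))
      (exit (written ls (out (reverse x))) (home x ∷ homes d))
    finish = reaches-≡ (cong (λ t → exit (written ls (out (reverse x))) (t ∷ homes d)) (home-ʳ++ x))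
      (subst (λ l → Reaches (suc n) (emb rewind (written ls (out (reverse x))) (at (blank ∷ []) l ∷ homes d))
                                         (exit (written ls (out (reverse x))) (tape (List.map bit x ʳ++ (blank ∷ [])) blank [] ∷ homes d)))
        (sym (trans (cong (_ʳ++ (blank ∷ [])) (List.reverse-map bit x))
                    (List.ʳ++-ʳ++ (List.map bit x) {[]})))
        (back x (blank ∷ [])))

-- The Turing machine of a loop program

module LoopMachine {d : ℕ} (p : Prog (suc d)) where

  State : Set
  State = Fin 4 ⊎ PC p

  pattern moveLeft  = inj₁ zero
  pattern moveRight = inj₁ (suc zero)
  pattern copy      = inj₁ (suc (suc zero))
  pattern halt      = inj₁ (suc (suc (suc zero)))

  δ : State → Vec Sym (2 + d) → Maybe (State × Vec (Sym × Move) (2 + d))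
  δ moveLeft  (o ∷ cs)         = just (moveRight , (o , stay) ∷ Vec.map (_, left) cs)
  δ moveRight (o ∷ cs)         = just (copy , (o , stay) ∷ Vec.map (_, right) cs)
  δ copy      (o ∷ bit b ∷ cs) = just (copy , (o , stay) ∷ Vec.replicate _ (bit b , right))
  δ copy      (o ∷ c ∷ cs)     = just (inj₂ (entry p) , (o , stay) ∷ idle (c ∷ cs))
  δ halt      _                = nothing
  δ (inj₂ s)  (o ∷ cs) with tr p s cs
  ... | r , e , as =
    just (maybe′ inj₂ halt r , maybe′ (λ b → bit b , right) (o , stay) e ∷ as)

  machine : DTM
  machine = record
    { State       = State
    ; Work        = ⊥
    ; finiteState = Finite-⊎ (Finite-Fin 4) (Finite-PC p)
    ; finiteWork  = Finite-⊥
    ; tapes       = 2 + d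
    ; input       = suc zero
    ; output      = zero
    ; start       = moveLeft
    ; δ           = δ
    }

  open DTM machine using (Config; next; initial; ComputesWithin)

  module _ (x : Word) where

    open Execution next x

    embed : PC p → Tape ⊥ → Vec (Tape ⊥) (suc d) → Config
    embed s o ts = inj₂ s , o ∷ ts

    exit : Tape ⊥ → Vec (Tape ⊥) (suc d) → Config
    exit o ts = halt , o ∷ ts

    simulates : Simulates p embed exit
    simulates s o ts with tr p s (Vec.map cell ts)
    ... | just _  , nothing , _ = refl
    ... | just _  , just _  , _ = refl
    ... | nothing , nothing , _ = refl
    ... | nothing , just _  , _ = refl

    copying : ∀ ys ls → Reaches (suc (length ys))
      (copy , blankTape ∷ at ls (List.map bit ys) ∷ Vec.replicate d (at ls []))
      (embed (entry p) blankTape (Vec.replicate (suc d) (tape (List.map bit ys ʳ++ ls) blank [])))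
    copying [] ls = reaches-step (cong (λ ts → just (_ , blankTape ∷ _ ∷ ts)) (act-idle _))
      (0 , ≤-refl , done)
    copying (y ∷ ys) ls = reaches-step
      (cong₂ (λ t ts → just (copy , blankTape ∷ t ∷ ts))
        (move-right ls (bit y) (List.map bit ys))
        (Vec.zipWith-replicate act (bit y , right) (at ls [])))
      (copying ys (bit y ∷ ls))

    others : ∀ m (t : Tape ⊥) → let ts = Vec.replicate d t in
             Vec.zipWith act (Vec.map (_, m) (Vec.map cell ts)) ts ≡ Vec.replicate d (move m t)
    others m t = trans (act-move m _) (Vec.map-replicate (move m) t d)

    padLeft : ∀ y → move right (move left (inputTape y)) ≡ at (blank ∷ []) (List.map bit y)
    padLeft []      = refl
    padLeft (b ∷ y) = refl

    run : Reaches (2 + (suc n + time p n)) (initial x) (exit (written [] (⟦ p ⟧ x)) (homes (suc d)))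
    run = reaches-step (cong (λ ts → just (moveRight , blankTape ∷ _ ∷ ts)) (others left blankTape))
      (reaches-step (cong₂ (λ t ts → just (copy , blankTape ∷ t ∷ ts))
                      (padLeft x) (others right (move left blankTape)))
        (reaches-trans
          (reaches-≡ (cong (λ t → embed (entry p) blankTape (Vec.replicate (suc d) t)) (home-ʳ++ x))
            (copying x (blank ∷ [])))
          (exec p embed exit simulates [])))

    holds : ∀ w → Holds (written [] w) w
    holds w = 0 , 1 , List.ʳ++-ʳ++ (List.map bit w) {[]}

    computes : ComputesWithin (2 + (suc n + time p n)) x (⟦ p ⟧ x)
    computes with run
    ... | m , m≤ , steps = m , _ , m≤ , steps , refl , holds (⟦ p ⟧ x)

-- Polynomial bounds

Poly : (ℕ → ℕ) → Set
Poly f = ∃[ c ] ∃[ k ] ∀ n → f n ≤ c * n ^ k + c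

poly-≤ : ∀ {f g} → (∀ n → f n ≤ g n) → Poly g → Poly f
poly-≤ f≤g (c , k , p) = c , k , λ n → ≤-trans (f≤g n) (p n)

poly-const : ∀ a → Poly (λ _ → a)
poly-const a = a , 0 , λ n → m≤n+m a _

-- The `+ 1` is for `n = 0`, where raising the exponent from 0 lowers the power from 1 to 0.
^-weaken : ∀ n j k → n ^ j ≤ n ^ (j + k) + 1
^-weaken zero    zero    k = m≤n+m 1 _
^-weaken zero    (suc j) k = z≤n
^-weaken (suc n) j       k = m≤n⇒m≤n+o 1 (^-monoʳ-≤ (suc n) (m≤m+n j k))

poly-+ : ∀ {f g} → Poly f → Poly g → Poly (λ n → f n + g n)
poly-+ {f} {g} (c , j , p) (e , k , q) = 2 * (c + e) , j + k , bound
  where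
  open ≤-Reasoning
  bound : ∀ n → f n + g n ≤ 2 * (c + e) * n ^ (j + k) + 2 * (c + e)
  bound n = begin
    f n + g n                               ≤⟨ +-mono-≤ (p n) (q n) ⟩
    (c * n ^ j + c) + (e * n ^ k + e)       ≤⟨ +-mono-≤ (+-monoˡ-≤ c (*-monoʳ-≤ c (^-weaken n j k)))
                                                 (+-monoˡ-≤ e (*-monoʳ-≤ e
                                                   (subst (λ i → n ^ k ≤ n ^ i + 1) (+-comm k j) (^-weaken n k j)))) ⟩
    (c * (N + 1) + c) + (e * (N + 1) + e)   ≡⟨ regroup c e N ⟩
    (c + e) * N + 2 * (c + e)               ≤⟨ +-monoˡ-≤ _ (*-monoˡ-≤ N (m≤n*m (c + e) 2)) ⟩
    2 * (c + e) * N + 2 * (c + e)           ∎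
    where
    N = n ^ (j + k)
    regroup : ∀ c e N → (c * (N + 1) + c) + (e * (N + 1) + e) ≡ (c + e) * N + 2 * (c + e)
    regroup = solve-∀

poly-n* : ∀ {f} → Poly f → Poly (λ n → n * f n)
poly-n* {f} (c , k , p) = poly-≤ bound
  (poly-+ (c , suc k , λ n → m≤m+n (c * n ^ suc k) c) (c , 1 , λ n → m≤m+n (c * n ^ 1) c))
  where
  open ≤-Reasoning
  regroup : ∀ n N c → n * (c * N + c) ≡ c * (n * N) + c * (n * 1)
  regroup = solve-∀
  bound : ∀ n → n * f n ≤ c * n ^ suc k + c * n ^ 1
  bound n = ≤-trans (*-monoʳ-≤ n (p n)) (≤-reflexive (regroup n (n ^ k) c))

poly-id : Poly (λ n → n)
poly-id = 1 , 1 , λ n → ≤-trans (≤-reflexive (sym (trans (*-identityˡ (n * 1)) (*-identityʳ n)))) (m≤m+n _ 1)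

poly-time : ∀ {d} (p : Prog d) → Poly (time p)
poly-time (emit _) = poly-const 1
poly-time (p ⨾ q)  = poly-+ (poly-time p) (poly-time q)
poly-time (loop f) = poly-+
  (poly-n* (poly-+ (poly-const 2) (poly-+ (poly-time (f false)) (poly-time (f true)))))
  (poly-+ poly-id (poly-const 3))

PolyTime-⟦⟧ : ∀ {d} (p : Prog (suc d)) {f : Word → Word} → (∀ x → ⟦ p ⟧ x ≡ f x) → PolyTime f
PolyTime-⟦⟧ p {f} p≗f =
  fromPoly (poly-+ (poly-const 2) (poly-+ (poly-+ (poly-const 1) poly-id) (poly-time p)))
  where
  open LoopMachine p
  fromPoly : Poly (λ n → 2 + (suc n + time p n)) → PolyTime f
  fromPoly (c , k , bound) = machine , c , k , λ x →
    subst (DTM.ComputesWithin machine (c * length x ^ k + c) x) (p≗f x) (relax x (computes x))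
    where
    relax : ∀ x → DTM.ComputesWithin machine (2 + (suc (length x) + time p (length x))) x (⟦ p ⟧ x) →
            DTM.ComputesWithin machine (c * length x ^ k + c) x (⟦ p ⟧ x)
    relax x (m , e , m≤ , r) = m , e , ≤-trans m≤ (bound (length x)) , r

-- Words computed by loop programs

Computable : ℕ → (Word → Word) → Set
Computable d h = Σ[ p ∈ Prog d ] (∀ x → ⟦ p ⟧ x ≡ h x)

constᶜ : ∀ {d} w → Computable d (λ _ → w)
constᶜ []      = emit nothing , λ _ → refl
constᶜ (b ∷ w) = emit (just b) ⨾ proj₁ (constᶜ w) , λ x → cong (b ∷_) (proj₂ (constᶜ w) x)

infixr 5 _++ᶜ_

_++ᶜ_ : ∀ {d h h′} → Computable d h → Computable d h′ → Computable d (λ x → h x ++ h′ x)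
(p , e) ++ᶜ (q , e′) = p ⨾ q , λ x → cong₂ _++_ (e x) (e′ x)

mapᶜ : ∀ {d h h′} → (∀ x → h x ≡ h′ x) → Computable d h → Computable d h′
mapᶜ h≗h′ (p , e) = p , λ x → trans (e x) (h≗h′ x)

loopᶜ : ∀ {d} {h : Bool → Word → Word} → (∀ b → Computable d (h b)) →
        Computable (suc d) (λ x → concatMap (λ b → h b x) (reverse x))
loopᶜ c = loop (λ b → proj₁ (c b)) , λ x → List.concatMap-cong (λ b → proj₂ (c b) x) (reverse x)

ones : ℕ → ℕᵇ
ones zero    = zero
ones (suc m) = 1+[2 ones m ]

digits : ℕ → Word
digits zero    = []
digits (suc m) = true ∷ false ∷ digits m

digits-+ : ∀ m n → digits (m + n) ≡ digits m ++ digits n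
digits-+ zero    n = refl
digits-+ (suc m) n = cong (λ w → true ∷ false ∷ w) (digits-+ m n)

digits-* : ∀ n (xs : Word) → concatMap (λ _ → digits n) xs ≡ digits (length xs * n)
digits-* n []       = refl
digits-* n (_ ∷ xs) = trans (cong (digits n ++_) (digits-* n xs)) (sym (digits-+ n _))

encode-ones : ∀ m → encodeℕᵇ (ones m) ≡ digits m ++ false ∷ []
encode-ones zero    = refl
encode-ones (suc m) = cong (λ w → true ∷ false ∷ w) (encode-ones m)

val-ones : ∀ m → suc (val (ones m)) ≡ 2 ^ m
val-ones zero    = refl
val-ones (suc m) = trans (sym (*-suc 2 (val (ones m)))) (cong (2 *_) (val-ones m))

digitsᶜ-power : ∀ d → Computable d (λ x → digits (length x ^ d))
digitsᶜ-power zero    = constᶜ (digits 1)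
digitsᶜ-power (suc d) = mapᶜ
  (λ x → trans (digits-* (length x ^ d) (reverse x))
               (cong (λ l → digits (l * length x ^ d)) (List.length-reverse x)))
  (loopᶜ (λ _ → digitsᶜ-power d))

digitsᶜ-+ : ∀ {d m n} → Computable d (digits ∘ m) → Computable d (digits ∘ n) →
            Computable d (λ x → digits (m x + n x))
digitsᶜ-+ {m = m} {n} c c′ = mapᶜ (λ x → sym (digits-+ (m x) (n x))) (c ++ᶜ c′)

digitsᶜ-* : ∀ {d m} j → Computable d (digits ∘ m) → Computable d (λ x → digits (j * m x))
digitsᶜ-* zero    c = constᶜ []
digitsᶜ-* (suc j) c = digitsᶜ-+ c (digitsᶜ-* j c)

-- One `⟨ B ⟩` reaches every shorter prefix, so a link only says `j < i` and may skip indices.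
Chain : (Bool → ℕ → Set) → (ℕ → Set) → Word → ℕ → Set
Chain L Q []      i = Q i
Chain L Q (b ∷ x) i = L b i × (∃[ j ] j < i × Chain L Q x j)

-- The complete Kripke structure, each state of which is its own only letter

module Complete {S : ℕ} (w : Fin S) where

  graph : Kripke
  graph = record
    { letters    = S
    ; states     = S
    ; δ          = λ _ → Subset.⊤
    ; left-total = λ v → v , ∈⊤
    ; μ          = ⁅_⁆
    ; w₀         = w
    }

  open Track

  track : ∀ (p : List (Fin S)) → 2 ≤ length p → Track graph
  track p 2≤ = record { path = p ; long = 2≤ ; linked = linked-all p }
    where
    linked-all : ∀ p → Linked (λ v u → u Subset.∈ Subset.⊤) p
    linked-all []          = []
    linked-all (v ∷ [])    = [-]
    linked-all (v ∷ u ∷ p) = ∈⊤ ∷ linked-all (u ∷ p)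

  -- ρ lists the values of g up to 1 + i.  The index i is the number of
  -- proper prefixes of ρ.
  Lists : (ℕ → Fin S) → ℕ → Track graph → Set
  Lists g i ρ = path ρ ≡ applyUpTo g (2 + i)

  lists : ∀ g i → Σ[ ρ ∈ Track graph ] Lists g i ρ
  lists g i = track (applyUpTo g (2 + i)) (s≤s (s≤s z≤n)) , refl

  enumerate : ∀ ρ → ∃[ g ] ∃[ i ] Lists g i ρ
  enumerate record { path = v ∷ u ∷ p ; long = s≤s (s≤s _) } =
    index (v ∷ u ∷ p) , length p , index-applyUpTo (v ∷ u ∷ p)
    where
    index : List (Fin S) → ℕ → Fin S
    index []      _       = v
    index (a ∷ _) zero    = a
    index (_ ∷ p) (suc i) = index p i
    index-applyUpTo : ∀ p → p ≡ applyUpTo (index p) (length p)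
    index-applyUpTo []      = refl
    index-applyUpTo (a ∷ p) = cong (a ∷_) (index-applyUpTo p)

  last-just : ∀ {X : Set} (p : List X) → 2 ≤ length p → ∃[ v ] List.last p ≡ just v
  last-just (v ∷ [])    _ = v , refl
  last-just (_ ∷ u ∷ []) _ = u , refl
  last-just (_ ∷ u ∷ t ∷ p) _ = last-just (u ∷ t ∷ p) (s≤s (s≤s z≤n))

  -- Prefixes of a track list the same `g`, so `g` stays fixed and a track is represented by its
  -- index alone. The offset 2 in `Lists` lets indices start at 0 although prefixes have at least
  -- two states.
  Sat-B : ∀ g ρ {i φ} {Q : ℕ → Set} → Lists g i ρ →
          (∀ j σ → Lists g j σ → Sat graph σ φ ⇔ Q j) →
          Sat graph ρ (⟨ B ⟩ φ) ⇔ (∃[ j ] j < i × Q j)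
  Sat-B g ρ {i} {φ} {Q} ρ≡ φ⇔ = mk⇔ forth back
    where
    length-≡ : length (path ρ) ∸ 2 ≡ i
    length-≡ = cong (_∸ 2) (trans (cong length ρ≡) (List.length-applyUpTo g (2 + i)))
    prefix : ∀ j {k} → j ≤ k → List.take j (applyUpTo g k) ≡ applyUpTo g j
    prefix j j≤k = go g j j≤k
      where
      go : ∀ g j {k} → j ≤ k → List.take j (applyUpTo g k) ≡ applyUpTo g j
      go g zero    _        = refl
      go g (suc j) (s≤s j≤) = cong (g 0 ∷_) (go (g ∘ suc) j j≤)
    forth : Sat graph ρ (⟨ B ⟩ φ) → ∃[ j ] j < i × Q j
    forth (σ , (suc j , _ , j< , σ≡) , sat) = j , j<i , to (φ⇔ j σ
      (trans σ≡ (trans (cong (List.take (2 + j)) ρ≡) (prefix (2 + j) (s≤s (m≤n⇒m≤1+n j<i)))))) sat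
      where
      j<i : suc j ≤ i
      j<i = subst (suc j ≤_) length-≡ j<
    back : ∃[ j ] j < i × Q j → Sat graph ρ (⟨ B ⟩ φ)
    back (j , j<i , q) = proj₁ (lists g j) ,
      (suc j , s≤s z≤n , subst (suc j ≤_) (sym length-≡) j<i ,
       sym (trans (cong (List.take (2 + j)) ρ≡) (prefix (2 + j) (s≤s (m≤n⇒m≤1+n j<i))))) ,
      from (φ⇔ j _ refl) q

  Sat-B^ : ∀ g {φ h} → (∀ i ρ → Lists g i ρ → Sat graph ρ φ ⇔ h ≤ i) →
           ∀ k i ρ → Lists g i ρ → Sat graph ρ (fold φ ⟨ B ⟩_ k) ⇔ k + h ≤ i
  Sat-B^ g φ⇔ zero    i ρ ρ≡ = φ⇔ i ρ ρ≡
  Sat-B^ g {h = h} φ⇔ (suc k) i ρ ρ≡ = mk⇔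
    (λ sat → let (j , j<i , le) = to (Sat-B g ρ ρ≡ (Sat-B^ g φ⇔ k)) sat in ≤-trans (s≤s le) j<i)
    (λ le → from (Sat-B g ρ ρ≡ (Sat-B^ g φ⇔ k)) (k + h , le , ≤-refl))

  -- A letter must hold in every state of a track, so it cannot be tested on the track itself.
  -- `⟨ A ⟩` passes to a track starting in the last state, and completeness of the graph provides
  -- the one that repeats this state.
  Sat-A : ∀ g ρ {i} a → Lists g i ρ → Sat graph ρ (⟨ A ⟩ letter a) ⇔ g (suc i) ≡ a
  Sat-A g ρ {i} a ρ≡ = mk⇔ forth back
    where
    last-applyUpTo : ∀ g i → List.last (applyUpTo g (suc i)) ≡ just (g i)
    last-applyUpTo g zero    = refl
    last-applyUpTo g (suc i) = last-applyUpTo (g ∘ suc) i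
    last-≡ : List.last (path ρ) ≡ just (g (suc i))
    last-≡ = trans (cong List.last ρ≡) (last-applyUpTo g (suc i))
    head-≡ : ∀ {v} p → 2 ≤ length p → just v ≡ List.head p → All (λ u → a Subset.∈ ⁅ u ⁆) p → v ≡ a
    head-≡ (u ∷ p) _ refl (a∈ ∷ _) = sym (x∈⁅y⁆⇒x≡y u a∈)
    forth : Sat graph ρ (⟨ A ⟩ letter a) → g (suc i) ≡ a
    forth (σ , lst≡ , sat) = head-≡ (path σ) (long σ) (trans (sym last-≡) lst≡) sat
    back : g (suc i) ≡ a → Sat graph ρ (⟨ A ⟩ letter a)
    back refl = track (_ ∷ _ ∷ []) (s≤s (s≤s z≤n)) , last-≡ , x∈⁅x⁆ _ ∷ x∈⁅x⁆ _ ∷ []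

  Sat-conjunction : ∀ {ρ f} {Q : ℕ → Set} → (∀ t → Sat graph ρ (f t) ⇔ Q t) → ∀ l k →
                    Sat graph ρ (conjunction f l k) ⇔ (∀ t → l ≤ t → t ≤ l + k → Q t)
  Sat-conjunction {Q = Q} f⇔ l zero = mk⇔
    (λ sat t l≤t t≤l → subst Q (≤-antisym l≤t (subst (t ≤_) (+-identityʳ l) t≤l)) (to (f⇔ l) sat))
    (λ q → from (f⇔ l) (q l ≤-refl (m≤m+n l 0)))
  Sat-conjunction {ρ} {f} {Q} f⇔ l (suc k) = mk⇔ forth back
    where
    forth : Sat graph ρ (conjunction f l (suc k)) → ∀ t → l ≤ t → t ≤ l + suc k → Q t
    forth (s , sat) t l≤t t≤ with m≤n⇒m<n∨m≡n l≤t
    ... | inj₁ l<t  = to (Sat-conjunction f⇔ (suc l) k) sat t l<t (subst (t ≤_) (+-suc l k) t≤)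
    ... | inj₂ refl = to (f⇔ l) s
    back : (∀ t → l ≤ t → t ≤ l + suc k → Q t) → Sat graph ρ (conjunction f l (suc k))
    back q = from (f⇔ l) (q l ≤-refl (m≤m+n l _)) ,
      from (Sat-conjunction f⇔ (suc l) k)
        (λ t l<t t≤ → q t (<⇒≤ l<t) (subst (t ≤_) (sym (+-suc l k)) t≤))

  -- Properties of tracks defined by computable formulas

  Property : ℕ → Set₁
  Property n = Word → Vec ℕ n → (ℕ → Fin S) → ℕ → Set

  -- P x η g i is a property of the tracks that list g up to 1 + i.
  record Definable (d : ℕ) {n : ℕ} (P : Property n) : Set where
    field
      formula    : Word → Succinct S n
      computable : Computable d (λ x → encodeSuccinct (formula x))
      valid      : ∀ x η → Valid η (formula x)
      meaning    : ∀ x η g i ρ → Lists g i ρ → Sat graph ρ (expand η (formula x)) ⇔ P x η g i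

  open Definable public

  mapᴰ : ∀ {d n} {P Q : Property n} → (∀ x η g i → P x η g i ⇔ Q x η g i) →
         Definable d P → Definable d Q
  mapᴰ P⇔Q p = record
    { formula    = formula p
    ; computable = computable p
    ; valid      = valid p
    ; meaning    = λ x η g i ρ ρ≡ → mk⇔
        (to (P⇔Q x η g i) ∘ to (meaning p x η g i ρ ρ≡))
        (from (meaning p x η g i ρ ρ≡) ∘ from (P⇔Q x η g i))
    }

  infixr 6 _×ᴰ_
  infix  7 ¬ᴰ_ ◇ᴰ_

  ¬ᴰ_ : ∀ {d n} {P : Property n} → Definable d P → Definable d (λ x η g i → ¬ P x η g i)
  ¬ᴰ p = record
    { formula    = λ x → ¬′ formula p x
    ; computable = constᶜ _ ++ᶜ computable p
    ; valid      = valid p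
    ; meaning    = λ x η g i ρ ρ≡ → mk⇔
        (λ ¬sat → ¬sat ∘ from (meaning p x η g i ρ ρ≡))
        (λ ¬P → ¬P ∘ to (meaning p x η g i ρ ρ≡))
    }

  _×ᴰ_ : ∀ {d n} {P Q : Property n} → Definable d P → Definable d Q →
         Definable d (λ x η g i → P x η g i × Q x η g i)
  p ×ᴰ q = record
    { formula    = λ x → formula p x ∧′ formula q x
    ; computable = constᶜ (false ∷ true ∷ false ∷ []) ++ᶜ computable p ++ᶜ computable q
    ; valid      = λ x η → valid p x η , valid q x η
    ; meaning    = λ x η g i ρ ρ≡ → meaning p x η g i ρ ρ≡ ×-⇔ meaning q x η g i ρ ρ≡
    }

  one : ℕᵇ
  one = 1+[2 zero ]

  ◇ᴰ_ : ∀ {d n} {P : Property n} → Definable d P →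
        Definable d (λ x η g i → ∃[ j ] j < i × P x η g j)
  ◇ᴰ p = record
    { formula    = λ x → ⟨ B ⟩^ (const one) (formula p x)
    ; computable = constᶜ _ ++ᶜ computable p
    ; valid      = λ x η → ℤ.+≤+ z≤n , valid p x η
    ; meaning    = λ x η g i ρ ρ≡ → Sat-B g ρ ρ≡ (meaning p x η g)
    }

  lastᴰ : ∀ {d n} a → Definable d {n} (λ x η g i → g (suc i) ≡ a)
  lastᴰ a = record
    { formula    = λ x → ⟨ A ⟩^ (const one) (letter a)
    ; computable = constᶜ _
    ; valid      = λ x η → ℤ.+≤+ z≤n , tt
    ; meaning    = λ x η g i ρ ρ≡ → Sat-A g ρ a ρ≡
    }

  ⊤ᴰ : ∀ {d n} → Definable d {n} (λ x η g i → ⊤)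
  ⊤ᴰ = mapᴰ (λ x η g i → mk⇔ _ (λ _ (p , ¬p) → ¬p p)) (¬ᴰ (lastᴰ w ×ᴰ ¬ᴰ lastᴰ w))

  -- `X` is decided while the formula is built, independently of the input, so it leaves no trace in
  -- the formula.
  guardᴰ : ∀ {d n X} {P : Property n} → Dec X → Definable d P → Definable d (λ x η g i → X → P x η g i)
  guardᴰ (yes p) q = mapᴰ (λ x η g i → mk⇔ (λ r _ → r) (λ f → f p)) q
  guardᴰ (no ¬p) q = mapᴰ (λ x η g i → mk⇔ (λ _ p → contradiction p ¬p) _) ⊤ᴰ

  ∀ᴰ : ∀ {d n s} {P : Fin s → Property n} → (∀ a → Definable d (P a)) →
       Definable d (λ x η g i → ∀ a → P a x η g i)
  ∀ᴰ {s = zero}  p = mapᴰ (λ x η g i → mk⇔ (λ _ ()) _) ⊤ᴰ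
  ∀ᴰ {s = suc s} p = mapᴰ
    (λ x η g i → mk⇔ (λ { (q , r) zero → q ; (q , r) (suc a) → r a }) (λ q → q zero , q ∘ suc))
    (p zero ×ᴰ ∀ᴰ (p ∘ suc))

  -- A disjunction over letters, written as "none of the other letters"; decidability of `X` removes
  -- the double negation.
  lastInᴰ : ∀ {d n} {X : Fin S → Set} → (∀ a → Dec (X a)) → Definable d {n} (λ x η g i → X (g (suc i)))
  lastInᴰ X? = mapᴰ
    (λ x η g i → mk⇔ (λ f → decidable-stable (X? _) (λ ¬p → f _ ¬p refl)) (λ { p a ¬p refl → ¬p p }))
    (∀ᴰ (λ a → guardᴰ (¬? (X? a)) (¬ᴰ lastᴰ a)))

  alwaysᴰ : ∀ {d n} {P : Property n} {X : Fin S → Set} → Definable d P → (∀ a → Dec (X a)) →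
            Definable d (λ x η g i → ∀ j → j < i → P x η g j → X (g (suc j)))
  alwaysᴰ p X? = mapᴰ
    (λ x η g i → mk⇔ (λ f j j<i q → decidable-stable (X? _) (λ ¬r → f (j , j<i , q , ¬r)))
                     (λ f (j , j<i , q , ¬r) → ¬r (f j j<i q)))
    (¬ᴰ ◇ᴰ (p ×ᴰ lastInᴰ (λ a → ¬? (X? a))))

  -- Numbers enter formulas only as lower bounds on the index: such bounds add up when blocks of
  -- `⟨ B ⟩` are stacked, and exact positions follow by negating the bound for the successor.
  Beyond : ∀ d {n} → (Word → Vec ℕ n → ℕ) → Set
  Beyond d h = Definable d (λ x η g i → h x η ≤ i)

  zeroᴰ : ∀ {d n} → Beyond d {n} (λ _ _ → 0)
  zeroᴰ = mapᴰ (λ _ _ _ _ → mk⇔ (λ _ → z≤n) _) ⊤ᴰ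

  sucᴰ : ∀ {d n} {h : Word → Vec ℕ n → ℕ} → Beyond d h → Beyond d (λ x η → suc (h x η))
  sucᴰ p = mapᴰ
    (λ x η g i → mk⇔ (λ (j , j<i , le) → ≤-trans (s≤s le) j<i) (λ lt → _ , lt , ≤-refl)) (◇ᴰ p)

  castᴰ : ∀ {d n} {h h′ : Word → Vec ℕ n → ℕ} → (∀ x η → h x η ≡ h′ x η) → Beyond d h → Beyond d h′
  castᴰ h≡ = mapᴰ (λ x η g i → subst (λ k → _ ⇔ k ≤ i) (h≡ x η) (mk⇔ id id))

  exactlyᴰ : ∀ {d n} {h : Word → Vec ℕ n → ℕ} → Beyond d h → Definable d (λ x η g i → i ≡ h x η)
  exactlyᴰ {h = h} p = mapᴰ
    (λ x η g i → mk⇔ (λ (le , ¬lt) → ≤-antisym (s≤s⁻¹ (≰⇒> ¬lt)) le)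
                     (λ { refl → ≤-refl , <-irrefl refl }))
    (p ×ᴰ ¬ᴰ sucᴰ p)

  atᴰ : ∀ {d n} {h : Word → Vec ℕ n → ℕ} → Beyond d h → ∀ a →
        Definable d (λ x η g i → h x η < i × g (suc (h x η)) ≡ a)
  atᴰ p a = mapᴰ
    (λ x η g i → mk⇔ (λ { (_ , lt , refl , e) → lt , e }) (λ (lt , e) → _ , lt , refl , e))
    (◇ᴰ (exactlyᴰ p ×ᴰ lastᴰ a))

  numberᴰ : ∀ {d n} {h : Word → Vec ℕ n → ℕ} (a : Word → ℕᵇ) → Computable d (encodeℕᵇ ∘ a) →
            Beyond d h → Beyond d (λ x η → val (a x) + h x η)
  numberᴰ a c p = record
    { formula    = λ x → ⟨ B ⟩^ (const (a x)) (formula p x)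
    -- The codes of `⟨_⟩^`, of `B` and of `const`, in this order.
    ; computable = constᶜ (false ∷ true ∷ true ∷ false ∷ true ∷ false ∷ false ∷ []) ++ᶜ c ++ᶜ computable p
    ; valid      = λ x η → ℤ.+≤+ z≤n , valid p x η
    ; meaning    = λ x η g → Sat-B^ g (meaning p x η g) (val (a x))
    }

  indexᴰ : ∀ {d n} {h : Word → Vec ℕ (suc n) → ℕ} → Beyond d h →
           Beyond d (λ x η → Vec.head η + h x η)
  indexᴰ {h = h} p = record
    { formula    = λ x → ⟨ B ⟩^ index (formula p x)
    ; computable = constᶜ _ ++ᶜ computable p
    ; valid      = λ x η → subst (ℤ.+ 0 ℤ.≤_) (sym (exponent-≡ η)) (ℤ.+≤+ z≤n) , valid p x η
    ; meaning    = λ x η g i ρ ρ≡ →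
        subst (λ k → Sat graph ρ (fold (expand η (formula p x)) ⟨ B ⟩_ k) ⇔ Vec.head η + h x η ≤ i)
          (sym (cong ∣_∣ (exponent-≡ η)))
          (Sat-B^ g (meaning p x η g) (Vec.head η) i ρ ρ≡)
    }
    where
    index : ∀ {n} → Exponent (suc n)
    index = affine (Sign.+ , one) zero (Sign.+ , zero)
    exponent-≡ : ∀ {n} (η : Vec ℕ (suc n)) → exponent η index ≡ ℤ.+ Vec.head η
    exponent-≡ (t ∷ η) = trans (ℤ.+-identityʳ _) (ℤ.*-identityˡ (ℤ.+ t))

  ⋀ᴰ : ∀ {d n} {P : Property (suc n)} (r : Word → ℕᵇ) → Computable d (encodeℕᵇ ∘ r) →
       Definable d P → Definable d (λ x η g i → ∀ t → t ≤ val (r x) → P x (t ∷ η) g i)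
  ⋀ᴰ r c p = record
    { formula    = λ x → ⋀ zero (r x) (formula p x)
    ; computable = constᶜ (true ∷ false ∷ true ∷ false ∷ []) ++ᶜ c ++ᶜ computable p
    ; valid      = λ x η → z≤n , λ t _ _ → valid p x (t ∷ η)
    ; meaning    = λ x η g i ρ ρ≡ →
        let conj = Sat-conjunction (λ t → meaning p x (t ∷ η) g i ρ ρ≡) 0 (val (r x)) in
        mk⇔ (λ sat t t≤ → to conj sat t z≤n t≤) (λ q → from conj (λ t _ t≤ → q t t≤))
    }

  -- In prefix notation each link ends where the code of the remaining chain begins, so the code is
  -- a concatenation over letters that one loop prints. The loop scans backwards, which suits the
  -- descending indices of a chain.
  chainᴰ : ∀ {d n} {L : Bool → Property n} {Q : Property n} →
           (∀ b → Definable d (L b)) → Definable (suc d) Q →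
           Definable (suc d) (λ x η g → Chain (λ b → L b x η g) (Q x η g) (reverse x))
  chainᴰ {d} {n} {L} {Q} l q = record
    { formula    = λ x → chain x (reverse x)
    ; computable = mapᶜ (λ x → encode-chain x (reverse x)) (loopᶜ linkᶜ ++ᶜ computable q)
    ; valid      = λ x η → chain-valid x η (reverse x)
    ; meaning    = λ x η g → chain-meaning x η g (reverse x)
    }
    where
    ∧-code ◇-code : Word
    ∧-code = false ∷ true ∷ false ∷ []
    ◇-code = false ∷ true ∷ true ∷ encodeModality B ++ encodeExponent {n} (const one)

    chain : Word → Word → Succinct S n
    chain x []       = formula q x
    chain x (b ∷ ys) = formula (l b) x ∧′ ⟨ B ⟩^ (const one) (chain x ys)

    link : Bool → Word → Word
    link b x = ∧-code ++ encodeSuccinct (formula (l b) x) ++ ◇-code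

    linkᶜ : ∀ b → Computable d (link b)
    linkᶜ b = constᶜ ∧-code ++ᶜ computable (l b) ++ᶜ constᶜ ◇-code

    encode-chain : ∀ x ys → concatMap (λ b → link b x) ys ++ encodeSuccinct (formula q x)
                            ≡ encodeSuccinct (chain x ys)
    encode-chain x []       = refl
    encode-chain x (b ∷ ys) = cong (∧-code ++_)
      (trans (cong (_++ rest) (List.++-assoc enc ◇-code links))
      (trans (List.++-assoc enc (◇-code ++ links) rest)
             (cong (λ w → enc ++ ◇-code ++ w) (encode-chain x ys))))
      where
      enc = encodeSuccinct (formula (l b) x)
      links = concatMap (λ b → link b x) ys
      rest = encodeSuccinct (formula q x)

    chain-valid : ∀ x η ys → Valid η (chain x ys)
    chain-valid x η []       = valid q x η
    chain-valid x η (b ∷ ys) = valid (l b) x η , ℤ.+≤+ z≤n , chain-valid x η ys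

    chain-meaning : ∀ x η g ys i ρ → Lists g i ρ →
      Sat graph ρ (expand η (chain x ys)) ⇔ Chain (λ b → L b x η g) (Q x η g) ys i
    chain-meaning x η g []       i ρ ρ≡ = meaning q x η g i ρ ρ≡
    chain-meaning x η g (b ∷ ys) i ρ ρ≡ =
      meaning (l b) x η g i ρ ρ≡ ×-⇔ Sat-B g ρ ρ≡ (chain-meaning x η g ys)

  -- Printing the length in binary would need arithmetic; instead it is counted in unary, by a chain
  -- whose links say nothing.
  lengthᴰ : ∀ {d n} {h : Word → Vec ℕ n → ℕ} → Beyond (suc d) h →
            Beyond (suc d) (λ x η → length x + h x η)
  lengthᴰ {h = h} p = mapᴰ
    (λ x η g i → subst (λ l → Chain (λ _ _ → ⊤) (h x η ≤_) (reverse x) i ⇔ l + h x η ≤ i)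
                       (List.length-reverse x) (count (reverse x)))
    (chainᴰ (λ _ → ⊤ᴰ) p)
    where
    count : ∀ {k} ys {i} → Chain (λ _ _ → ⊤) (k ≤_) ys i ⇔ length ys + k ≤ i
    count []       = mk⇔ id id
    count (_ ∷ ys) = mk⇔
      (λ (_ , j , j<i , c) → ≤-trans (s≤s (to (count ys) c)) j<i)
      (λ le → tt , _ , le , from (count ys) ≤-refl)

Finite⇒≟ : {X : Set} → Finite X → DecidableEquality X
Finite⇒≟ (n , e) = via-injection (↔⇒↣ e) Fin._≟_

snoc : {C : Set} {_⟶_ : C → C → Set} {n : ℕ} {c c′ c″ : C} →
       Steps _⟶_ n c c′ → c′ ⟶ c″ → Steps _⟶_ (suc n) c c″
snoc done    s = s ◅ done
snoc (r ◅ rs) s = r ◅ snoc rs s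

-- Tapes as functions

module _ {W : Set} where

  nth : List (Symbol W) → ℕ → Symbol W
  nth []       _       = blank
  nth (a ∷ _)  zero    = a
  nth (_ ∷ as) (suc k) = nth as k

  -- content h t s is the symbol at position s when the head of t is at
  -- position h.
  content : ℕ → Tape W → ℕ → Symbol W
  content zero    t s = nth (cell t ∷ after t) s
  content (suc h) t s = content h (move left t) s

  -- Agreement is assumed at the position `s` only. This covers both a change of the head cell,
  -- invisible elsewhere, and a right end padded with a blank.
  content-cong : ∀ h ls {a b} {rs rs′ : List (Symbol W)} {s} →
    (∀ k → s ≡ h + k → nth (a ∷ rs) k ≡ nth (b ∷ rs′) k) →
    content h (tape ls a rs) s ≡ content h (tape ls b rs′) s
  content-cong zero    ls f = f _ refl
  content-cong (suc h) [] f = content-cong h []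
    λ { zero _ → refl ; (suc k) e → f k (trans e (+-suc h k)) }
  content-cong (suc h) (l ∷ ls) f = content-cong h ls
    λ { zero _ → refl ; (suc k) e → f k (trans e (+-suc h k)) }

  content-+ : ∀ h ls (a : Symbol W) rs k → content h (tape ls a rs) (h + k) ≡ nth (a ∷ rs) k
  content-+ zero    ls       a rs k = refl
  content-+ (suc h) []       a rs k = trans (cong (content h (tape [] blank (a ∷ rs))) (sym (+-suc h k)))
                                            (content-+ h [] blank (a ∷ rs) (suc k))
  content-+ (suc h) (l ∷ ls) a rs k = trans (cong (content h (tape ls l (a ∷ rs))) (sym (+-suc h k)))
                                            (content-+ h ls l (a ∷ rs) (suc k))

  content-head : ∀ h t → content h t h ≡ cell t
  content-head h (tape ls a rs) = trans (cong (content h (tape ls a rs)) (sym (+-identityʳ h)))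
                                        (content-+ h ls a rs 0)

  content-write : ∀ h a t {s} → s ≢ h → content h (write a t) s ≡ content h t s
  content-write h a (tape ls b rs) s≢h = content-cong h ls
    λ { zero e → contradiction (trans e (+-identityʳ h)) s≢h ; (suc k) _ → refl }

  content-right : ∀ h t s → content (suc h) (move right t) s ≡ content h t s
  content-right h (tape ls a (r ∷ rs)) s = refl
  content-right h (tape ls a [])       s = content-cong h ls
    λ { zero _ → refl ; (suc zero) _ → refl ; (suc (suc k)) _ → refl }

  content-before : ∀ h a (rs : List (Symbol W)) {s} → s < h → content h (tape [] a rs) s ≡ blank
  content-before (suc h) a rs (s≤s s≤h) with m≤n⇒m<n∨m≡n s≤h
  ... | inj₁ s<h  = content-before h blank (a ∷ rs) s<h
  ... | inj₂ refl = content-head h (tape [] blank (a ∷ rs))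

  shift : Move → ℕ → ℕ
  shift left  h = pred h
  shift stay  h = h
  shift right h = suc h

  content-move : ∀ m h t s → 0 < h → content (shift m h) (move m t) s ≡ content h t s
  content-move left  (suc h) t s _ = refl
  content-move stay  h       t s _ = refl
  content-move right h       t s _ = content-right h t s

-- Tableaux of a nondeterministic machine

module Computation (M : NTM) where

  open NTM M

  -- The cell under the head also records the state and the action that
  -- the machine is about to perform.
  Action Cell : Set
  Action = State × Symbol Work × Move
  Cell   = Symbol Work × Maybe (State × Action)

  headState : Cell → Maybe State
  headState c = Maybe.map proj₁ (proj₂ c)

  overwritten : Cell → Symbol Work
  overwritten (a , nothing)              = a
  overwritten (a , just (_ , _ , a′ , _)) = a′

  leave : Move → Action → Maybe State
  leave left  (q , _ , left)  = just q
  leave stay  (q , _ , stay)  = just q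
  leave right (q , _ , right) = just q
  leave _     _               = nothing

  leaving : Move → Cell → Maybe State
  leaving m (_ , nothing)      = nothing
  leaving m (_ , just (_ , α)) = leave m α

  -- In a correct part of a row there is one head, hence at most one of the three is defined and the
  -- order of `<∣>` is immaterial.
  arriving : Cell → Cell → Cell → Maybe State
  arriving l c r = leaving right l <∣> leaving stay c <∣> leaving left r

  -- A machine may also wait, so that computations can be prolonged.
  options : State → Symbol Work → List Action
  options q a = (q , a , stay) ∷ δ q a

  Legal : Cell → Set
  Legal (_ , nothing)      = ⊤
  Legal (a , just (q , α)) = α ∈ options q a

  -- d is the cell below c, whose neighbours are l and r.
  Window : Cell → Cell → Cell → Cell → Set
  Window l c r d = Legal c × proj₁ d ≡ overwritten c × headState d ≡ arriving l c r

  -- Abstract, since nothing below depends on the numbering of the cells.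
  abstract

    finiteSymbol : Finite (Symbol Work)
    finiteSymbol = Finite-Symbol finiteWork

    finiteAction : Finite Action
    finiteAction = Finite-× finiteState (Finite-× finiteSymbol Finite-Move)

    finiteCell : Finite Cell
    finiteCell = Finite-× finiteSymbol (Finite-Maybe (Finite-× finiteState finiteAction))

    finiteMaybeState : Finite (Maybe State)
    finiteMaybeState = Finite-Maybe finiteState

  open DecMembership (Finite⇒≟ finiteAction) using (_∈?_)

  legal? : ∀ c → Dec (Legal c)
  legal? (_ , nothing)      = yes tt
  legal? (a , just (q , α)) = α ∈? options q a

  window? : ∀ l c r d → Dec (Window l c r d)
  window? l c r d = legal? c ×-dec Finite⇒≟ finiteSymbol (proj₁ d) (overwritten c)
    ×-dec Finite⇒≟ finiteMaybeState (headState d) (arriving l c r)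

  acceptingCell : Cell → Bool
  acceptingCell c = maybe′ accepting false (headState c)

  headAt : State → ℕ → ℕ → Maybe State
  headAt q h s = if s ≡ᵇ h then just q else nothing

  headAt-self : ∀ q h → headAt q h h ≡ just q
  headAt-self q h = cong (λ b → if b then just q else nothing) (to T-≡ (≡⇒≡ᵇ h h refl))

  -- The tableau f lists rows of N cells, but the right neighbour of the
  -- last cell of a row is the first cell of the next row.  Errors
  -- entering from there travel one cell per row, so row t is only
  -- claimed to be correct at distance t from both ends.
  record Row (N H : ℕ) (f : ℕ → Cell) (t : ℕ) (q : State) (u : Tape Work) (h : ℕ) : Set where
    field
      symbols : ∀ s → t ≤ s → s + t < N → proj₁ (f (t * N + s)) ≡ content h u s
      heads   : ∀ s → t ≤ s → s + t < N → headState (f (t * N + s)) ≡ headAt q h s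
      low     : H ≤ h + t
      high    : h ≤ H + t

  -- In the first `D` steps the head stays within distance `D` of `H`, while errors stay within the
  -- outer `D` cells on either side; the two inequalities keep these zones apart.
  module Simulation (N H D : ℕ) (2D≤H : D + D ≤ H) (H+2D<N : H + D + D < N) where

    module _ {f : ℕ → Cell} {t q u h} (t<D : t < D) (row : Row N H f t q u h) where

      open Row row

      t<h : t < h
      t<h = +-cancelʳ-≤ t (suc t) h (≤-trans (+-mono-≤ t<D (<⇒≤ t<D)) (≤-trans 2D≤H low))

      h+t<N : h + t < N
      h+t<N = ≤-<-trans (≤-trans (+-monoˡ-≤ t high)
        (+-mono-≤ (+-monoʳ-≤ H (<⇒≤ t<D)) (<⇒≤ t<D))) H+2D<N

      headCell : proj₁ (f (t * N + h)) ≡ cell u × ∃[ α ] proj₂ (f (t * N + h)) ≡ just (q , α)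
      headCell = trans (symbols h (<⇒≤ t<h) h+t<N) (content-head h u) ,
        go (proj₂ (f (t * N + h))) (trans (heads h (<⇒≤ t<h) h+t<N) (headAt-self q h))
        where
        go : ∀ c → Maybe.map proj₁ c ≡ just q → ∃[ α ] c ≡ just (q , α)
        go (just (q , α)) refl = α , refl

    module _ {f : ℕ → Cell} {t q u h} (t<D : t < D) (row : Row N H f t q u h)
             {α : Action} (α≡ : proj₂ (f (t * N + h)) ≡ just (q , α))
             (windows : ∀ i → i < D * N → Window (f i) (f (suc i)) (f (2 + i)) (f (suc i + N)))
             where

      open Row row

      private
        m = proj₂ (proj₂ α)

      atHead : ∀ s → t ≤ s → s + t < N →
               (s ≡ᵇ h) ≡ true  × s ≡ h × proj₂ (f (t * N + s)) ≡ just (q , α) ⊎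
               (s ≡ᵇ h) ≡ false × s ≢ h × proj₂ (f (t * N + s)) ≡ nothing
      atHead s t≤s s<N with s ≡ᵇ h in eq | heads s t≤s s<N
      ... | true  | _ with ≡ᵇ⇒≡ s h (from T-≡ eq)
      ...   | refl = inj₁ (refl , refl , α≡)
      atHead s t≤s s<N | false | e = inj₂ (refl ,
        (λ { refl → subst T eq (≡⇒≡ᵇ s s refl) }) , none _ e)
        where
        none : ∀ (c : Maybe (State × Action)) → Maybe.map proj₁ c ≡ nothing → c ≡ nothing
        none nothing _ = refl

      leaving-≡ : ∀ m′ s → t ≤ s → s + t < N →
                  leaving m′ (f (t * N + s)) ≡ (if s ≡ᵇ h then leave m′ α else nothing)
      leaving-≡ m′ s t≤s s<N with atHead s t≤s s<N
      ... | inj₁ (e , _ , hd) rewrite e = lemma (f (t * N + s)) hd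
        where
        lemma : ∀ c → proj₂ c ≡ just (q , α) → leaving m′ c ≡ leave m′ α
        lemma (_ , just _) refl = refl
      ... | inj₂ (e , _ , hd) rewrite e = lemma (f (t * N + s)) hd
        where
        lemma : ∀ c → proj₂ c ≡ nothing → leaving m′ c ≡ nothing
        lemma (_ , nothing) refl = refl

      arriving-≡ : ∀ α h s → 0 < h →
        ((if s ≡ᵇ h then leave right α else nothing) <∣>
         (if suc s ≡ᵇ h then leave stay α else nothing) <∣>
         (if suc (suc s) ≡ᵇ h then leave left α else nothing))
        ≡ headAt (proj₁ α) (shift {Work} (proj₂ (proj₂ α)) h) (suc s)
      arriving-≡ (q , _ , left)  (suc h) s _ with s ≡ᵇ suc h | s ≡ᵇ h
      ... | true  | true  = refl
      ... | true  | false = refl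
      ... | false | true  = refl
      ... | false | false = refl
      arriving-≡ (q , _ , stay)  (suc h) s _ with s ≡ᵇ suc h | s ≡ᵇ h | suc s ≡ᵇ h
      ... | true  | true  | true  = refl
      ... | true  | true  | false = refl
      ... | true  | false | true  = refl
      ... | true  | false | false = refl
      ... | false | true  | true  = refl
      ... | false | true  | false = refl
      ... | false | false | true  = refl
      ... | false | false | false = refl
      arriving-≡ (q , _ , right) (suc h) s _ with s ≡ᵇ suc h | s ≡ᵇ h | suc s ≡ᵇ h
      ... | true  | true  | true  = refl
      ... | true  | true  | false = refl
      ... | true  | false | true  = refl
      ... | true  | false | false = refl
      ... | false | true  | true  = refl
      ... | false | true  | false = refl
      ... | false | false | true  = refl
      ... | false | false | false = refl

      -- A window checks the legality of its middle cell only, so the relevant window starts one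
      -- cell before the head; it exists because `t < h`.
      legal : α ∈ options q (cell u)
      legal = subst (λ a → α ∈ options q a) (proj₁ (headCell t<D row)) (lemma (f (t * N + h)) α≡ legal-cell)
        where
        lemma : ∀ c → proj₂ c ≡ just (q , α) → Legal c → α ∈ options q (proj₁ c)
        lemma (_ , just _) refl l = l
        index : ∃[ s ] suc s ≡ h
        index with s≤s {n = s} _ ← t<h t<D row = s , refl
        in-range : ∀ s → suc s ≡ h → t * N + s < D * N
        in-range s refl = <-≤-trans (+-monoʳ-< (t * N) (≤-trans (m≤m+n (suc s) t) (<⇒≤ (h+t<N t<D row))))
          (≤-trans (≤-reflexive (+-comm (t * N) N)) (*-monoˡ-≤ N t<D))
        legal-cell : Legal (f (t * N + h))
        legal-cell with s , refl ← index =
          subst (Legal ∘ f) (sym (+-suc (t * N) s)) (proj₁ (windows (t * N + s) (in-range s refl)))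

      row-suc : Row N H f (suc t) (proj₁ α) (act (proj₂ α) u) (shift {Work} m h)
      row-suc = record { symbols = symbols′ ; heads = heads′ ; low = low′ m ; high = high′ m }
        where
        0<h : 0 < h
        0<h = ≤-<-trans z≤n (t<h t<D row)
        module _ (s : ℕ) (t≤s : t ≤ s) (s+t<N : suc s + suc t < N) where
          s<N : s + t < N
          s<N = ≤-trans (s≤s (+-mono-≤ (n≤1+n s) (n≤1+n t))) s+t<N
          s₁<N : suc s + t < N
          s₁<N = ≤-trans (s≤s (+-monoʳ-≤ (suc s) (n≤1+n t))) s+t<N
          s₂<N : suc (suc s) + t < N
          s₂<N = subst (_< N) (+-suc (suc s) t) s+t<N
          i<DN : t * N + s < D * N
          i<DN = <-≤-trans (+-monoʳ-< (t * N) (≤-<-trans (m≤m+n s t) s<N))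
            (≤-trans (≤-reflexive (+-comm (t * N) N)) (*-monoˡ-≤ N t<D))
          below : suc (t * N + s) + N ≡ suc t * N + suc s
          below = regroup (t * N) s N
            where
            regroup : ∀ a s n → suc (a + s) + n ≡ (n + a) + suc s
            regroup = solve-∀
          e₁ : suc (t * N + s) ≡ t * N + suc s
          e₁ = sym (+-suc (t * N) s)
          e₂ : suc (suc (t * N + s)) ≡ t * N + suc (suc s)
          e₂ = trans (cong suc e₁) (sym (+-suc (t * N) (suc s)))
          window : Window (f (t * N + s)) (f (t * N + suc s)) (f (t * N + suc (suc s))) (f (suc t * N + suc s))
          window = subst (λ j → Window (f (t * N + s)) (f (t * N + suc s)) (f (t * N + suc (suc s))) (f j)) below
            (subst₂ (λ j k → Window (f (t * N + s)) (f j) (f k) (f (suc (t * N + s) + N))) e₁ e₂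
              (windows (t * N + s) i<DN))
          symbol-≡ : proj₁ (f (suc t * N + suc s)) ≡ content (shift {Work} m h) (act (proj₂ α) u) (suc s)
          symbol-≡ with atHead (suc s) (m≤n⇒m≤1+n t≤s) s₁<N
          ... | inj₁ (_ , refl , hd) = trans (proj₁ (proj₂ window)) (trans (lemma (f (t * N + suc s)) hd)
                  (sym (trans (content-move m (suc s) _ (suc s) 0<h) (content-head (suc s) _))))
            where
            lemma : ∀ c → proj₂ c ≡ just (q , α) → overwritten c ≡ proj₁ (proj₂ α)
            lemma (_ , just _) refl = refl
          ... | inj₂ (_ , s≢h , hd) = trans (proj₁ (proj₂ window)) (trans (lemma (f (t * N + suc s)) hd)
                  (trans (symbols (suc s) (m≤n⇒m≤1+n t≤s) s₁<N)
                    (sym (trans (content-move m h _ (suc s) 0<h) (content-write h _ u s≢h)))))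
            where
            lemma : ∀ c → proj₂ c ≡ nothing → overwritten c ≡ proj₁ c
            lemma (_ , nothing) refl = refl
          head-≡ : headState (f (suc t * N + suc s)) ≡ headAt (proj₁ α) (shift {Work} m h) (suc s)
          head-≡ = trans (proj₂ (proj₂ window))
            (trans (cong₂ _<∣>_ (leaving-≡ right s t≤s s<N)
                     (cong₂ _<∣>_ (leaving-≡ stay (suc s) (m≤n⇒m≤1+n t≤s) s₁<N)
                                  (leaving-≡ left (suc (suc s)) (m≤n⇒m≤1+n (m≤n⇒m≤1+n t≤s)) s₂<N)))
                   (arriving-≡ α h s 0<h))
        symbols′ : ∀ s → suc t ≤ s → s + suc t < N →
                   proj₁ (f (suc t * N + s)) ≡ content (shift {Work} m h) (act (proj₂ α) u) s
        symbols′ (suc s) (s≤s t≤s) = symbol-≡ s t≤s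
        heads′ : ∀ s → suc t ≤ s → s + suc t < N →
                 headState (f (suc t * N + s)) ≡ headAt (proj₁ α) (shift {Work} m h) s
        heads′ (suc s) (s≤s t≤s) = head-≡ s t≤s
        low′ : ∀ m → H ≤ shift {Work} m h + suc t
        low′ left  = subst (H ≤_) (sym (trans (+-suc (pred h) t) (cong (_+ t) (suc-pred h {{>-nonZero 0<h}})))) low
        low′ stay  = ≤-trans low (+-monoʳ-≤ h (n≤1+n t))
        low′ right = ≤-trans low (+-mono-≤ (n≤1+n h) (n≤1+n t))
        high′ : ∀ m → shift {Work} m h ≤ H + suc t
        high′ left  = ≤-trans pred[n]≤n (≤-trans high (+-monoʳ-≤ H (n≤1+n t)))
        high′ stay  = ≤-trans high (+-monoʳ-≤ H (n≤1+n t))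
        high′ right = subst (suc h ≤_) (sym (+-suc H t)) (s≤s high)

    -- From a tableau to a computation

    module Soundness {f : ℕ → Cell} {x : Word}
      (initialRow : Row N H f 0 start (inputTape x) H)
      (windows : ∀ i → i < D * N → Window (f i) (f (suc i)) (f (2 + i)) (f (suc i + N))) where

      reach : ∀ t → t ≤ D → ∃[ n ] ∃[ q ] ∃[ u ] ∃[ h ]
              Steps _⟶_ n (initial x) (q , u) × Row N H f t q u h
      reach zero    _   = 0 , _ , _ , _ , done , initialRow
      reach (suc t) t<D with reach t (<⇒≤ t<D)
      ... | n , q , u , h , r , row with proj₂ (headCell t<D row)
      ...   | α , α≡ with legal t<D row α≡ windows | row-suc t<D row α≡ windows
      -- The first option is waiting: the row advances, the computation does not.
      ...     | here refl | row′ = n , _ , _ , _ , r , row′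
      ...     | there α∈  | row′ = suc n , _ , _ , _ , snoc r (step α∈) , row′

      accepts : ∀ s → D ≤ s → s + D < N → T (acceptingCell (f (D * N + s))) → Accepts x
      accepts s D≤s s+D<N acc with reach D ≤-refl
      ... | n , q , u , h , r , row = n , _ , r ,
        go (s ≡ᵇ h) (subst (λ m → T (maybe′ accepting false m)) (Row.heads row s D≤s s+D<N) acc)
        where
        go : ∀ b → T (maybe′ accepting false (if b then just q else nothing)) → T (accepting q)
        go true a = a

    -- From a computation to a tableau

    module Completeness {x : Word} (2≤N : 2 ≤ N) where

      instance
        N≢0 : NonZero N
        N≢0 = >-nonZero (≤-trans (s≤s z≤n) 2≤N)

      -- Heads may also appear among the erroneous cells near the borders, where the scripted action
      -- can be illegal. Falling back on waiting, which is always legal, makes every window of the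
      -- tableau hold, even there and after the run has ended.
      choose : Maybe Action → State → Symbol Work → Action
      choose nothing  q a = q , a , stay
      choose (just α) q a with α ∈? δ q a
      ... | yes _ = α
      ... | no  _ = q , a , stay

      choose-legal : ∀ α q a → choose α q a ∈ options q a
      choose-legal nothing  q a = here refl
      choose-legal (just α) q a with α ∈? δ q a
      ... | yes α∈ = there α∈
      ... | no  _  = here refl

      choose-∈ : ∀ {α q a} → α ∈ δ q a → choose (just α) q a ≡ α
      choose-∈ {α} {q} {a} α∈ with α ∈? δ q a
      ... | yes _  = refl
      ... | no  α∉ = contradiction α∈ α∉

      -- script t is the action to be taken in row t, as far as it is possible.
      module Build (script : ℕ → Maybe Action) where

        cellWith : ℕ → Symbol Work → Maybe State → Cell
        cellWith i a q = a , Maybe.map (λ q → q , choose (script (i / N)) q a) q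

        initialCell : ℕ → Cell
        initialCell i = cellWith i (content H (inputTape x) i) (headAt start H i)

        nextCell : ℕ → Cell → Cell → Cell → Cell
        nextCell i l c r = cellWith i (overwritten c) (arriving l c r)

        -- The first argument is fuel; it suffices if it is at least the index.
        fill : ℕ → ℕ → Cell
        fill zero    i = initialCell i
        -- The lowest cell determined by a window is `suc N`; so besides row 0 also the first cell
        -- of row 1 is free.
        fill (suc k) i with i ≤? N
        ... | yes _ = initialCell i
        ... | no  _ = nextCell i (fill k (i ∸ suc N)) (fill k (suc (i ∸ suc N))) (fill k (2 + (i ∸ suc N)))

        f : ℕ → Cell
        f i = fill i i

        fill-low : ∀ k {i} → i ≤ N → fill k i ≡ initialCell i
        fill-low zero    _ = refl
        fill-low (suc k) {i} i≤N with i ≤? N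
        ... | yes _  = refl
        ... | no i≰N = contradiction i≤N i≰N

        fill-high : ∀ k i → fill (suc k) (suc i + N) ≡
                    nextCell (suc i + N) (fill k i) (fill k (suc i)) (fill k (2 + i))
        fill-high k i with suc i + N ≤? N
        ... | yes le = contradiction (m≤n+m N i) (<⇒≱ le)
        ... | no  _  rewrite m+n∸n≡m i N = refl

        fill-suc : ∀ k i → i ≤ k → fill (suc k) i ≡ fill k i
        fill-suc k i i≤k with i ≤? N
        ... | yes i≤N = sym (fill-low k i≤N)
        fill-suc zero    zero    z≤n | no i≰N = contradiction z≤n i≰N
        fill-suc (suc k) i       i≤k | no i≰N = sym (trans (cong (fill (suc k)) (sym i≡))
          (trans (fill-high k j)
            (trans (sym (cong₂ (λ l (c , r) → nextCell (suc j + N) l c r)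
                      (fill-suc k j (≤-trans (m≤n+m j 2) j₂≤k))
                      (cong₂ _,_ (fill-suc k (suc j) (≤-trans (n≤1+n (suc j)) j₂≤k)) (fill-suc k (2 + j) j₂≤k))))
              (cong (λ i → nextCell i (fill (suc k) j) (fill (suc k) (suc j)) (fill (suc k) (2 + j))) i≡))))
          where
          j = i ∸ suc N
          i≡ : suc j + N ≡ i
          i≡ = trans (sym (+-suc j N)) (m∸n+n≡m (≰⇒> i≰N))
          -- `2 ≤ N` makes even the right upper neighbour `2 + j` precede `i`, which is `suc j + N`;
          -- one unit less of fuel suffices for it.
          j₂≤k : 2 + j ≤ k
          j₂≤k = ≤-trans (≤-trans (≤-reflexive (+-comm 2 j)) (+-monoʳ-≤ j 2≤N))
            (s≤s⁻¹ (≤-trans (≤-reflexive i≡) i≤k))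

        fill-+ : ∀ i d → fill (d + i) i ≡ f i
        fill-+ i zero    = refl
        fill-+ i (suc d) = trans (fill-suc (d + i) i (m≤n+m i d)) (fill-+ i d)

        fill-≡ : ∀ {k i} → i ≤ k → fill k i ≡ f i
        fill-≡ {k} {i} i≤k = subst (λ k → fill k i ≡ f i) (m∸n+n≡m i≤k) (fill-+ i (k ∸ i))

        f-next : ∀ i → f (suc i + N) ≡ nextCell (suc i + N) (f i) (f (suc i)) (f (2 + i))
        f-next i = trans (fill-high (i + N) i)
          (cong₂ (λ l (c , r) → nextCell (suc i + N) l c r) (fill-≡ (m≤m+n i N))
            (cong₂ _,_ (fill-≡ (≤-trans (n≤1+n (suc i)) i₂≤)) (fill-≡ i₂≤)))
          where
          i₂≤ : 2 + i ≤ i + N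
          i₂≤ = ≤-trans (≤-reflexive (+-comm 2 i)) (+-monoʳ-≤ i 2≤N)

        f-cellWith : ∀ i → ∃[ a ] ∃[ q ] f i ≡ cellWith i a q
        f-cellWith i with i ≤? N
        ... | yes i≤N = content H (inputTape x) i , headAt start H i , fill-low i i≤N
        ... | no  i≰N = a , q , subst (λ i → f i ≡ cellWith i a q) i≡ (f-next j)
          where
          j = i ∸ suc N
          a = overwritten (f (suc j))
          q = arriving (f j) (f (suc j)) (f (2 + j))
          i≡ : suc j + N ≡ i
          i≡ = trans (sym (+-suc j N)) (m∸n+n≡m (≰⇒> i≰N))

        headState-cellWith : ∀ i a q → headState (cellWith i a q) ≡ q
        headState-cellWith i a nothing  = refl
        headState-cellWith i a (just q) = refl

        legal-cellWith : ∀ i a q → Legal (cellWith i a q)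
        legal-cellWith i a nothing  = tt
        legal-cellWith i a (just q) = choose-legal (script (i / N)) q a

        windows : ∀ i → Window (f i) (f (suc i)) (f (2 + i)) (f (suc i + N))
        windows i with f-cellWith (suc i)
        ... | a , q , e = subst Legal (sym e) (legal-cellWith (suc i) a q) ,
          cong proj₁ (f-next i) , trans (cong headState (f-next i)) (headState-cellWith (suc i + N) _ _)

        chosen : ∀ i {q α} → proj₂ (f i) ≡ just (q , α) → α ≡ choose (script (i / N)) q (proj₁ (f i))
        chosen i e with f i | f-cellWith i
        chosen i refl | _ | a , just q , refl = refl

        initialRow : Row N H f 0 start (inputTape x) H
        initialRow = record
          { symbols = λ s _ s<N → cong proj₁ (low-≡ s<N)
          ; heads   = λ s _ s<N → trans (cong headState (low-≡ s<N)) (headState-cellWith s _ _)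
          ; low     = m≤m+n H 0
          ; high    = m≤m+n H 0
          }
          where
          low-≡ : ∀ {s} → s + 0 < N → f s ≡ initialCell s
          low-≡ {s} s<N = fill-low s (<⇒≤ (≤-<-trans (m≤m+n s 0) s<N))

      actions : ∀ {n c c′} → Steps _⟶_ n c c′ → ℕ → Maybe Action
      actions done                              k       = nothing
      actions (step {q′ = q′} {a = a} _ ◅ _)    zero    = just (q′ , a)
      actions (_ ◅ r)                           (suc k) = actions r k

      module Follow {n c} (run : Steps _⟶_ n (initial x) c) (n≤D : n ≤ D) where

        open Build (actions run) public

        row-/ : ∀ t {h} → h < N → (t * N + h) / N ≡ t
        row-/ t {h} h<N = trans (+-distrib-/-∣ˡ h (n∣m*n t))
          (trans (cong₂ _+_ (m*n/n≡m t N) (m<n⇒m/n≡0 h<N)) (+-identityʳ t))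

        -- `r` is the part of the run still ahead, and the script from `t` on consists of its
        -- actions. `m + t ≤ D` forces `r` to be empty in row `D`, so the state there is the final
        -- one.
        Following : ℕ → Set
        Following t = ∃[ m ] ∃[ q ] ∃[ u ] ∃[ h ] Σ[ r ∈ Steps _⟶_ m (q , u) c ]
          m + t ≤ D × (∀ k → actions run (t + k) ≡ actions r k) × Row N H f t q u h

        follow : ∀ t → t ≤ D → Following t
        follow zero    _   = n , _ , _ , _ , run , ≤-trans (≤-reflexive (+-identityʳ n)) n≤D ,
                             (λ k → refl) , initialRow
        follow (suc t) t<D with follow t (<⇒≤ t<D)
        ... | m , q , u , h , r , m+t≤D , script , row with headCell t<D row
        ...   | a≡ , α , α≡ = continue r m+t≤D script α-chosen
          where
          α-chosen : α ≡ choose (actions run t) q (cell u)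
          α-chosen = trans (chosen (t * N + h) α≡)
            (cong₂ (λ i a → choose (actions run i) q a)
              (row-/ t (≤-<-trans (m≤m+n h t) (h+t<N t<D row))) a≡)

          row′ : Row N H f (suc t) (proj₁ α) (act (proj₂ α) u) (shift {Work} (proj₂ (proj₂ α)) h)
          row′ = row-suc t<D row α≡ (λ i _ → windows i)

          continue : ∀ {m} (r : Steps _⟶_ m (q , u) c) → m + t ≤ D →
                     (∀ k → actions run (t + k) ≡ actions r k) →
                     α ≡ choose (actions run t) q (cell u) → Following (suc t)
          continue done m+t≤D script α≡′ with refl ← trans α≡′ (cong (λ β → choose β q (cell u))
              (trans (cong (actions run) (sym (+-identityʳ t))) (script 0))) =
            0 , _ , _ , _ , done , t<D , (λ k → trans (cong (actions run) (sym (+-suc t k))) (script (suc k))) , row′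
          continue (_◅_ {n = m} (step α∈) r) m+t≤D script α≡′ with refl ← trans α≡′ (trans (cong (λ β → choose β q (cell u))
              (trans (cong (actions run) (sym (+-identityʳ t))) (script 0))) (choose-∈ α∈)) =
            m , _ , _ , _ , r , ≤-trans (≤-reflexive (+-suc m t)) m+t≤D ,
            (λ k → trans (cong (actions run) (sym (+-suc t k))) (script (suc k))) , row′

        accepted : T (accepting (proj₁ c)) →
                   ∃[ h ] H ≤ h + D × h ≤ H + D × T (acceptingCell (f (D * N + h)))
        accepted acc with follow D ≤-refl
        ... | suc m , _ , _ , _ , r , m+D≤D , _ = contradiction (m≤n+m D m) (<⇒≱ m+D≤D)
        ... | zero , q , u , h , done , _ , _ , row = h , low , high ,
            subst (λ m → T (maybe′ accepting false m)) (sym (trans (heads h D≤h h+D<N) (headAt-self q h))) acc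
          where
          open Row row
          D≤h : D ≤ h
          D≤h = +-cancelʳ-≤ D D h (≤-trans 2D≤H low)
          h+D<N : h + D < N
          h+D<N = ≤-<-trans (+-monoˡ-≤ D high) H+2D<N

-- In each of the following inequalities the difference of the two sides
-- is a polynomial in r = P − 3 with nonnegative coefficients.

2P≤ : ∀ {P} → 3 ≤ P → P + P ≤ suc (2 * P ^ 2)
2P≤ (s≤s (s≤s (s≤s (z≤n {r})))) = ≤-trans (m≤m+n _ (13 + 10 * r + 2 * (r * r))) (≤-reflexive (eq r))
  where
  eq : ∀ r → (3 + r) + (3 + r) + (13 + 10 * r + 2 * (r * r)) ≡ suc (2 * ((3 + r) * ((3 + r) * 1)))
  eq = solve-∀

2P²+2P< : ∀ {P} → 3 ≤ P → suc (2 * P ^ 2) + P + P < 2 * P ^ 3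
2P²+2P< (s≤s (s≤s (s≤s (z≤n {r})))) = ≤-trans (m≤m+n _ (28 + 40 * r + 16 * (r * r) + 2 * (r * r * r))) (≤-reflexive (eq r))
  where
  eq : ∀ r → suc (suc (2 * ((3 + r) * ((3 + r) * 1))) + (3 + r) + (3 + r)) + (28 + 40 * r + 16 * (r * r) + 2 * (r * r * r))
       ≡ 2 * ((3 + r) * ((3 + r) * ((3 + r) * 1)))
  eq = solve-∀

4P²+P≤ : ∀ {P} → 3 ≤ P → 2 * P ^ 2 + 2 * P ^ 2 + P ≤ 2 * P ^ 3
4P²+P≤ (s≤s (s≤s (s≤s (z≤n {r})))) = ≤-trans (m≤m+n _ (15 + 29 * r + 14 * (r * r) + 2 * (r * r * r))) (≤-reflexive (eq r))
  where
  eq : ∀ r → 2 * ((3 + r) * ((3 + r) * 1)) + 2 * ((3 + r) * ((3 + r) * 1)) + (3 + r) + (15 + 29 * r + 14 * (r * r) + 2 * (r * r * r))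
       ≡ 2 * ((3 + r) * ((3 + r) * ((3 + r) * 1)))
  eq = solve-∀

3P≤ : ∀ {P} → 3 ≤ P → 2 * P ^ 1 + P ≤ suc (2 * P ^ 2)
3P≤ (s≤s (s≤s (s≤s (z≤n {r})))) = ≤-trans (m≤m+n _ (10 + 9 * r + 2 * (r * r))) (≤-reflexive (eq r))
  where
  eq : ∀ r → 2 * ((3 + r) * 1) + (3 + r) + (10 + 9 * r + 2 * (r * r)) ≡ suc (2 * ((3 + r) * ((3 + r) * 1)))
  eq = solve-∀

2P²+P< : ∀ {P} → 3 ≤ P → suc (2 * P ^ 2) + P < 2 * P ^ 2 + 2 * P ^ 2
2P²+P< (s≤s (s≤s (s≤s (z≤n {r})))) = ≤-trans (m≤m+n _ (13 + 11 * r + 2 * (r * r))) (≤-reflexive (eq r))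
  where
  eq : ∀ r → suc (suc (2 * ((3 + r) * ((3 + r) * 1))) + (3 + r)) + (13 + 11 * r + 2 * (r * r))
       ≡ 2 * ((3 + r) * ((3 + r) * 1)) + 2 * ((3 + r) * ((3 + r) * 1))
  eq = solve-∀

2P⁴+2P³< : ∀ {P} → 3 ≤ P → suc (2 * P ^ 4) + 2 * P ^ 3 < 2 * P ^ 5
2P⁴+2P³< (s≤s (s≤s (s≤s (z≤n {r})))) = ≤-trans (m≤m+n _ (268 + 540 * r + 414 * (r * r) + 154 * (r * r * r)
                       + 28 * (r * r * r * r) + 2 * (r * r * r * r * r)))
                   (≤-reflexive (eq r))
  where
  eq : ∀ r → suc (suc (2 * ((3 + r) * ((3 + r) * ((3 + r) * ((3 + r) * 1))))) + 2 * ((3 + r) * ((3 + r) * ((3 + r) * 1))))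
               + (268 + 540 * r + 414 * (r * r) + 154 * (r * r * r) + 28 * (r * r * r * r) + 2 * (r * r * r * r * r))
             ≡ 2 * ((3 + r) * ((3 + r) * ((3 + r) * ((3 + r) * ((3 + r) * 1)))))
  eq = solve-∀

n<2^n : ∀ n → n < 2 ^ n
n<2^n zero    = s≤s z≤n
n<2^n (suc n) = ≤-trans (s≤s (n<2^n n)) (≤-trans (+-monoˡ-≤ (2 ^ n) (m^n>0 2 n))
  (≤-reflexive (cong (2 ^ n +_) (sym (+-identityʳ (2 ^ n))))))

-- Chains

Spells : (Bool → ℕ → Set) → Word → ℕ → Set
Spells L []      h = ⊤
Spells L (b ∷ x) h = L b h × Spells L x (suc h)

chain-++ : ∀ L Q x y → Chain L Q (x ++ y) ≡ Chain L (Chain L Q y) x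
chain-++ L Q []      y = refl
chain-++ L Q (b ∷ x) y = cong (λ C i → L b i × (∃[ j ] j < i × C j)) (chain-++ L Q x y)

chain-reverse : ∀ L Q b x → Chain L Q (reverse (b ∷ x)) ≡ Chain L (Chain L Q (b ∷ [])) (reverse x)
chain-reverse L Q b x = trans (cong (Chain L Q) (List.unfold-reverse b x))
                              (chain-++ L Q (reverse x) (b ∷ []))

-- A chain of strict descents from length x + h to h cannot skip an
-- index.
chain⇒spells : ∀ {L} Q x {h} → (∀ i → Q i → h ≤ i) → ∀ {i} → i ≤ length x + h →
               Chain L Q (reverse x) i → Q h × Spells L x (suc h)
chain⇒spells Q []      low {i} i≤h q = subst Q (≤-antisym i≤h (low i q)) q , tt
chain⇒spells {L} Q (b ∷ x) {h} low {i} i≤ c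
  with chain⇒spells (Chain L Q (b ∷ [])) x
         (λ { j (_ , j′ , j′<j , q) → ≤-trans (s≤s (low j′ q)) j′<j })
         (subst (i ≤_) (sym (+-suc (length x) h)) i≤)
         (subst (λ C → C i) (chain-reverse L Q b x) c)
... | (l , j , j<1+h , q) , ls = subst Q (≤-antisym (s≤s⁻¹ j<1+h) (low j q)) q , l , ls

spells⇒chain : ∀ {L} Q x {h} → Q h → Spells L x (suc h) → Chain L Q (reverse x) (length x + h)
spells⇒chain Q [] q _ = q
spells⇒chain {L} Q (b ∷ x) {h} q (l , ls) =
  subst₂ (λ C i → C i) (sym (chain-reverse L Q b x)) (+-suc (length x) h)
    (spells⇒chain (Chain L Q (b ∷ [])) x (l , h , ≤-refl , q) ls)

module _ {W : Set} (f : ℕ → Symbol W) where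

  spells⇒nth : ∀ x {h} → Spells (λ b i → f i ≡ bit b) x h →
               ∀ p → p < length x → f (h + p) ≡ nth (List.map bit x) p
  spells⇒nth (b ∷ x) {h} (e , _)  zero    _         = trans (cong f (+-identityʳ h)) e
  spells⇒nth (b ∷ x) {h} (_ , es) (suc p) (s≤s p<n) = trans (cong f (+-suc h p)) (spells⇒nth x es p p<n)

  nth⇒spells : ∀ x {h} → (∀ p → p < length x → f (h + p) ≡ nth (List.map bit x) p) →
               Spells (λ b i → f i ≡ bit b) x h
  nth⇒spells []      e = tt
  nth⇒spells (b ∷ x) {h} e = trans (cong f (sym (+-identityʳ h))) (e 0 (s≤s z≤n)) ,
    nth⇒spells x (λ p p<n → trans (cong f (sym (+-suc h p))) (e (suc p) (s≤s p<n)))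

module _ {W : Set} where

  nth-beyond : ∀ (as : List (Symbol W)) {p} → length as ≤ p → nth as p ≡ blank
  nth-beyond []       _         = refl
  nth-beyond (a ∷ as) (s≤s le)  = nth-beyond as le

  content-input-before : ∀ h x {s} → s < h → content {W} h (inputTape x) s ≡ blank
  content-input-before h []      = content-before h blank []
  content-input-before h (b ∷ x) = content-before h (bit b) (List.map bit x)

  content-input : ∀ h x p → content {W} h (inputTape x) (h + p) ≡ nth (List.map bit x) p
  content-input h []      zero    = content-+ h [] blank [] 0
  content-input h []      (suc p) = content-+ h [] blank [] (suc p)
  content-input h (b ∷ x) p       = content-+ h [] (bit b) (List.map bit x) p

-- The tableau as a property of tracks

module Encoding (M : NTM) where

  open NTM M
  open Computation M

  S : ℕ
  S = proj₁ finiteCell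

  code : Cell → Fin S
  code = Inverse.to (proj₂ finiteCell)

  decode : Fin S → Cell
  decode = Inverse.from (proj₂ finiteCell)

  decode-code : ∀ a → decode (code a) ≡ a
  decode-code = Inverse.strictlyInverseʳ (proj₂ finiteCell)

  w : Fin S
  w = code (blank , nothing)

  open Complete w

  headIs? : ∀ s a → Dec (headState (decode a) ≡ s)
  headIs? s a = Finite⇒≟ finiteMaybeState (headState (decode a)) s

  symbolIs? : ∀ s a → Dec (proj₁ (decode a) ≡ s)
  symbolIs? s a = Finite⇒≟ finiteSymbol (proj₁ (decode a)) s

  -- Index 0 of the tableau is the second state of the track, because a
  -- track has no prefix of length 1.  Row 0 has the head at H, and
  -- acceptance is looked for at the indices from lo to hi, which lie in
  -- row D, where D bounds the number of steps.
  module Shape (x : Word) (H₀ N R lo hi L : ℕ) where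

    private
      -- After the first letter of the input, at `H`, the chain descends once more; its end `H₀` is
      -- thus one less than `H`.
      H = suc H₀

    module _ (g : ℕ → Fin S) (i : ℕ) where

      private
        f : ℕ → Cell
        f j = decode (g (suc j))

      Initial : Set
      Initial = (∀ j → j < i → j ≡ H → headState (f j) ≡ just start)
              × (∀ j → j < i → ¬ N ≤ j × j ≢ H → headState (f j) ≡ nothing)
              × (∀ j → j < i → ¬ H ≤ j → proj₁ (f j) ≡ blank)
              × (∀ j → j < i → length x + H ≤ j × ¬ N ≤ j → proj₁ (f j) ≡ blank)
              × (∃[ j ] j < i × ¬ length x + H ≤ j ×
                   Chain (λ b j → proj₁ (f j) ≡ bit b) (H₀ ≤_) (reverse x) j)

      -- The finitely many bad quadruples are forbidden one by one, because a cell can be tested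
      -- only by naming its value.
      Windows : Set
      Windows = ∀ t → t ≤ R → ∀ a b c d →
        ¬ Window (decode a) (decode b) (decode c) (decode d) →
        ¬ ((t < i × g (suc t) ≡ a) × (suc t < i × g (2 + t) ≡ b) ×
           (2 + t < i × g (3 + t) ≡ c) × (suc t + N < i × g (suc (suc t + N)) ≡ d))

      Accepting : Set
      Accepting = ∃[ j ] j < i × lo ≤ j × ¬ hi ≤ j × T (acceptingCell (f j))

      Tableau : Set
      Tableau = L ≤ i × Initial × Windows × Accepting

    -- `R+N<L` puts the lowest cell of every tested window inside the track. The first two bounds on
    -- `lo` and `hi` keep the interval away from the errors in row `D`; the last two make it contain
    -- every position that the head can have there.
    module Correctness (D : ℕ) (2D≤H : D + D ≤ H) (H+2D<N : H + D + D < N) (n≤D : length x ≤ D)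
      (DN≤R : D * N ≤ R) (R+N<L : suc R + N < L)
      (DN+D≤lo : D * N + D ≤ lo) (hi+D≤DN+N : hi + D ≤ D * N + N)
      (lo+D≤DN+H : lo + D ≤ D * N + H) (DN+H+D<hi : D * N + (H + D) < hi) where

      H+D<N : H + D < N
      H+D<N = ≤-<-trans (m≤m+n (H + D) D) H+2D<N

      n+H≤N : length x + H ≤ N
      n+H≤N = ≤-trans (≤-reflexive (+-comm (length x) H)) (≤-trans (+-monoʳ-≤ H n≤D) (<⇒≤ H+D<N))

      N<L : N < L
      N<L = ≤-<-trans (m≤n+m N (suc R)) R+N<L

      open Simulation N H D 2D≤H H+2D<N

      tableau⇒accepts : ∀ {g i} → Tableau g i → Accepts x
      tableau⇒accepts {g} {i} (L≤i , (heads₁ , heads₂ , left-blank , right-blank , chain) , windows , j , _ , lo≤j , hi≰j , acc) =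
        Soundness.accepts row₀ windows′ (j ∸ D * N) D≤s s+D<N (subst (T ∘ acceptingCell ∘ f) (sym j≡) acc)
        where
        f : ℕ → Cell
        f j = decode (g (suc j))
        N≤i : N ≤ i
        N≤i = ≤-trans (<⇒≤ N<L) L≤i
        input-≡ : ∀ p → p < length x → proj₁ (f (H + p)) ≡ nth (List.map bit x) p
        input-≡ = let (j , _ , ¬n+H≤j , ch) = chain in spells⇒nth (proj₁ ∘ f) x (proj₂ (chain⇒spells (H₀ ≤_) x (λ _ le → le)
                (s≤s⁻¹ (≤-trans (≰⇒> ¬n+H≤j) (≤-reflexive (+-suc (length x) H₀)))) ch))
        row₀ : Row N H f 0 start (inputTape x) H
        row₀ = record { symbols = symbols ; heads = heads ; low = m≤m+n _ 0 ; high = m≤m+n _ 0 }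
          where
          heads : ∀ s → 0 ≤ s → s + 0 < N → headState (f s) ≡ headAt start H s
          heads s _ s<N with s ≡ᵇ H in eq
          ... | true  = heads₁ s (<-≤-trans s<N′ N≤i) (≡ᵇ⇒≡ s H (from T-≡ eq))
            where s<N′ = ≤-<-trans (m≤m+n s 0) s<N
          ... | false = heads₂ s (<-≤-trans s<N′ N≤i)
                          (<⇒≱ s<N′ , λ { refl → subst T eq (≡⇒≡ᵇ s s refl) })
            where s<N′ = ≤-<-trans (m≤m+n s 0) s<N
          symbols : ∀ s → 0 ≤ s → s + 0 < N → proj₁ (f s) ≡ content H (inputTape x) s
          symbols s _ s+0<N with H ≤? s
          ... | no  H≰s = trans (left-blank s (<-≤-trans (≤-<-trans (m≤m+n s 0) s+0<N) N≤i) H≰s)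
                                (sym (content-input-before H x (≰⇒> H≰s)))
          ... | yes H≤s with p , refl ← m≤n⇒∃[o]m+o≡n H≤s with p <? length x
          ...   | yes p<n = trans (input-≡ p p<n) (sym (content-input H x p))
          ...   | no  p≮n = trans (right-blank (H + p) (<-≤-trans s<N N≤i)
                  (≤-trans (+-monoˡ-≤ H (≮⇒≥ p≮n)) (≤-reflexive (+-comm p H)) , <⇒≱ s<N))
                  (sym (trans (content-input H x p)
                    (nth-beyond (List.map bit x) (≤-trans (≤-reflexive (List.length-map bit x)) (≮⇒≥ p≮n)))))
            where
            s<N : H + p < N
            s<N = ≤-<-trans (m≤m+n _ 0) s+0<N
        windows′ : ∀ t → t < D * N → Window (f t) (f (suc t)) (f (2 + t)) (f (suc t + N))
        windows′ t t<DN = decidable-stable (window? (f t) (f (suc t)) (f (2 + t)) (f (suc t + N))) λ ¬win →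
          windows t t≤R (g (suc t)) (g (2 + t)) (g (3 + t)) (g (suc (suc t + N))) ¬win
            ((<-trans (n<1+n t) 1+t<i , refl) , (1+t<i , refl) , (2+t<i , refl) , (last<i , refl))
          where
          t≤R : t ≤ R
          t≤R = <⇒≤ (<-≤-trans t<DN DN≤R)
          last<i : suc t + N < i
          last<i = <-≤-trans (≤-<-trans (+-monoˡ-≤ N (s≤s t≤R)) R+N<L) L≤i
          2+t<i : 2 + t < i
          2+t<i = ≤-<-trans (≤-trans (≤-reflexive (cong suc (+-comm 1 t)))
            (+-monoʳ-≤ (suc t) (≤-trans (s≤s z≤n) (≤-<-trans z≤n H+D<N)))) last<i
          1+t<i : suc t < i
          1+t<i = <-trans (n<1+n (suc t)) 2+t<i
        s = j ∸ D * N
        j≡ : D * N + s ≡ j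
        j≡ = m+[n∸m]≡n (≤-trans (m≤m+n (D * N) D) (≤-trans DN+D≤lo lo≤j))
        D≤s : D ≤ s
        D≤s = +-cancelˡ-≤ (D * N) D s (≤-trans DN+D≤lo (≤-trans lo≤j (≤-reflexive (sym j≡))))
        s+D<N : s + D < N
        s+D<N = +-cancelˡ-< (D * N) (s + D) N (≤-<-trans
          (≤-reflexive (trans (sym (+-assoc (D * N) s D)) (cong (_+ D) j≡)))
          (<-≤-trans (+-monoˡ-< D (≰⇒> hi≰j)) hi+D≤DN+N))

      -- `g 0` lies before the tableau and is unconstrained, so it can be the last state `v` of
      -- whatever initial track is given; `⟨ A ⟩` then reaches `g`.
      accepts⇒tableau : (∀ {n c} → Steps _⟶_ n (initial x) c → n ≤ D) →
                        Accepts x → ∀ v → ∃[ g ] g 0 ≡ v × Tableau g L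
      accepts⇒tableau halts (n , e , run , acc) v = g , refl , ≤-refl ,
        (heads₁ , heads₂ , left-blank , right-blank , chain) , windows′ , accepting′
        where
        2≤N : 2 ≤ N
        2≤N = ≤-trans (s≤s (s≤s z≤n)) H+D<N
        open Completeness {x} 2≤N
        open Follow run (halts run)
        g : ℕ → Fin S
        g zero    = v
        g (suc j) = code (f j)
        f-≡ : ∀ j → decode (g (suc j)) ≡ f j
        f-≡ j = decode-code (f j)
        low-≡ : ∀ {j} → j ≤ N → decode (g (suc j)) ≡ initialCell j
        low-≡ {j} j≤N = trans (f-≡ j) (fill-low j j≤N)
        symbol-≡ : ∀ {j} → j ≤ N → proj₁ (decode (g (suc j))) ≡ content H (inputTape x) j
        symbol-≡ j≤N = cong proj₁ (low-≡ j≤N)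
        head-≡ : ∀ {j} → j ≤ N → headState (decode (g (suc j))) ≡ headAt start H j
        head-≡ {j} j≤N = trans (cong headState (low-≡ j≤N)) (headState-cellWith j _ _)
        H≤N : H ≤ N
        H≤N = <⇒≤ (≤-<-trans (m≤m+n H D) H+D<N)
        heads₁ : ∀ j → j < L → j ≡ H → headState (decode (g (suc j))) ≡ just start
        heads₁ j _ refl = trans (head-≡ H≤N) (headAt-self start H)
        heads₂ : ∀ j → j < L → ¬ N ≤ j × j ≢ H → headState (decode (g (suc j))) ≡ nothing
        heads₂ j _ (N≰j , j≢H) = trans (head-≡ (<⇒≤ (≰⇒> N≰j))) (elsewhere (j ≡ᵇ H) refl)
          where
          elsewhere : ∀ b → (j ≡ᵇ H) ≡ b → (if b then just start else nothing) ≡ nothing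
          elsewhere true  e = contradiction (≡ᵇ⇒≡ j H (from T-≡ e)) j≢H
          elsewhere false _ = refl
        left-blank : ∀ j → j < L → ¬ H ≤ j → proj₁ (decode (g (suc j))) ≡ blank
        left-blank j _ H≰j = trans (symbol-≡ (≤-trans (<⇒≤ (≰⇒> H≰j)) H≤N))
                                   (content-input-before H x (≰⇒> H≰j))
        right-blank : ∀ j → j < L → length x + H ≤ j × ¬ N ≤ j → proj₁ (decode (g (suc j))) ≡ blank
        right-blank j _ (n+H≤j , N≰j) with p , refl ← m≤n⇒∃[o]m+o≡n (≤-trans (m≤n+m H (length x)) n+H≤j) =
          trans (symbol-≡ (<⇒≤ (≰⇒> N≰j))) (trans (content-input H x p)
            (nth-beyond (List.map bit x) (≤-trans (≤-reflexive (List.length-map bit x))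
              (+-cancelʳ-≤ H (length x) p (≤-trans n+H≤j (≤-reflexive (+-comm H p)))))))
        chain : ∃[ j ] j < L × ¬ length x + H ≤ j ×
                  Chain (λ b j → proj₁ (decode (g (suc j))) ≡ bit b) (H₀ ≤_) (reverse x) j
        chain = length x + H₀ , <-≤-trans top< (≤-trans n+H≤N (<⇒≤ N<L)) , <⇒≱ top< ,
          spells⇒chain (H₀ ≤_) x ≤-refl (nth⇒spells (λ j → proj₁ (decode (g (suc j)))) x
            (λ p p<n → trans (symbol-≡ (≤-trans (≤-reflexive (+-comm H p))
                                (≤-trans (+-monoˡ-≤ H (<⇒≤ p<n)) n+H≤N)))
                             (content-input H x p)))
          where
          top< : length x + H₀ < length x + H
          top< = +-monoʳ-< (length x) (n<1+n H₀)
        windows′ : Windows g L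
        windows′ t _ _ _ _ _ ¬win ((_ , refl) , (_ , refl) , (_ , refl) , (_ , refl)) =
          ¬win (subst₂ (λ (a , b) (c , d) → Window a b c d)
                 (sym (cong₂ _,_ (f-≡ t) (f-≡ (suc t)))) (sym (cong₂ _,_ (f-≡ (2 + t)) (f-≡ (suc t + N))))
                 (windows t))
        accepting′ : Accepting g L
        accepting′ with accepted acc
        ... | h , low , high , a = D * N + h ,
            ≤-<-trans (+-mono-≤ (≤-trans DN≤R (n≤1+n R)) (<⇒≤ h<N)) R+N<L ,
            +-cancelʳ-≤ D lo (D * N + h) (≤-trans lo+D≤DN+H
              (≤-trans (+-monoʳ-≤ (D * N) low) (≤-reflexive (sym (+-assoc (D * N) h D))))) ,
            <⇒≱ (≤-<-trans (+-monoʳ-≤ (D * N) high) DN+H+D<hi) ,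
            subst (T ∘ acceptingCell) (sym (f-≡ (D * N + h))) a
          where
          h<N : h < N
          h<N = ≤-<-trans high H+D<N

-- The reduction

module Reduction (M : NTM) (c k : ℕ) where

  open NTM M
  open Computation M
  open Encoding M
  open Complete w

  -- The exponent `suc k` makes `D` exceed the input length even if `k` is 0; `c` absorbs the factor
  -- `c`, since `c < 2 ^ c`; the 2 gives `3 ≤ D` and covers the loss in `^-weaken`.
  m : Word → ℕ
  m x = length x ^ suc k + (c + 2)

  D : Word → ℕ
  D x = 2 ^ m x

  -- In bijective binary, 2ⁿ⁺¹ is a 2 followed by n ones.
  pw : ℕ → Word → ℕᵇ
  pw j x = 2[1+ ones (j * m x) ]

  q : ℕ → Word → ℕ
  q j x = 2 * D x ^ j

  -- Each exponent is one higher than the previous so that every margin fits: `q 1` is at least `D`,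
  -- `H` at least `q 1 + D`, and `N` at least twice `q 2` plus `D`. Moreover `D * N` is `q 4`, again
  -- printable.
  H N : Word → ℕ
  H x = suc (q 2 x)
  N x = q 3 x

  val-pw : ∀ j x → val (pw j x) ≡ q j x
  val-pw j x = cong (2 *_) (trans (val-ones (j * m x))
    (trans (cong (2 ^_) (*-comm j (m x))) (sym (^-*-assoc 2 (m x) j))))

  pwᶜ : ∀ j → Computable (suc k) (encodeℕᵇ ∘ pw j)
  pwᶜ j = mapᶜ (λ x → cong (λ w → true ∷ true ∷ w) (sym (encode-ones (j * m x))))
    (constᶜ (true ∷ true ∷ []) ++ᶜ digitsᶜ-* {m = m} j mᶜ ++ᶜ constᶜ (false ∷ []))
    where
    mᶜ : Computable (suc k) (digits ∘ m)
    mᶜ = digitsᶜ-+ (digitsᶜ-power (suc k)) (constᶜ (digits (c + 2)))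

  qᴰ : ∀ {n} j {h : Word → Vec ℕ n → ℕ} → Beyond (suc k) h → Beyond (suc k) (λ x η → q j x + h x η)
  qᴰ j {h} p = castᴰ (λ x η → cong (_+ h x η) (val-pw j x)) (numberᴰ (pw j) (pwᶜ j) p)

  q₀ᴰ : ∀ {n} j → Beyond (suc k) {n} (λ x η → q j x)
  q₀ᴰ j = castᴰ (λ x η → +-identityʳ (q j x)) (qᴰ j zeroᴰ)

  open module ShapeOf (x : Word) =
    Shape x (q 2 x) (N x) (val (pw 4 x)) (q 4 x + q 1 x) (q 4 x + (q 2 x + q 2 x)) (q 5 x)
    using (Tableau; Initial; Windows; Accepting)

  abstract

    tableauᴰ : Definable (suc k) {0} (λ x η g i → Tableau x g i)
    tableauᴰ = q₀ᴰ 5 ×ᴰ initialᴰ ×ᴰ windowsᴰ ×ᴰ acceptingᴰ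
      where
      Hᴰ : Beyond (suc k) {0} (λ x η → H x)
      Hᴰ = sucᴰ (q₀ᴰ 2)
      initialᴰ : Definable (suc k) {0} (λ x η g i → Initial x g i)
      initialᴰ = alwaysᴰ (exactlyᴰ Hᴰ) (headIs? (just start))
        ×ᴰ alwaysᴰ (¬ᴰ q₀ᴰ 3 ×ᴰ ¬ᴰ exactlyᴰ Hᴰ) (headIs? nothing)
        ×ᴰ alwaysᴰ (¬ᴰ Hᴰ) (symbolIs? blank)
        ×ᴰ alwaysᴰ (lengthᴰ Hᴰ ×ᴰ ¬ᴰ q₀ᴰ 3) (symbolIs? blank)
        ×ᴰ ◇ᴰ (¬ᴰ lengthᴰ Hᴰ ×ᴰ chainᴰ (λ b → lastInᴰ (symbolIs? (bit b))) (q₀ᴰ 2))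
      tᴰ : Beyond (suc k) {1} (λ x η → Vec.head η)
      tᴰ = castᴰ (λ x η → +-identityʳ (Vec.head η)) (indexᴰ zeroᴰ)
      windowsᴰ : Definable (suc k) {0} (λ x η g i → Windows x g i)
      windowsᴰ = ⋀ᴰ (pw 4) (pwᶜ 4) (∀ᴰ λ a → ∀ᴰ λ b → ∀ᴰ λ c → ∀ᴰ λ d →
        guardᴰ (¬? (window? (decode a) (decode b) (decode c) (decode d)))
          (¬ᴰ (atᴰ tᴰ a ×ᴰ atᴰ (sucᴰ tᴰ) b ×ᴰ atᴰ (sucᴰ (sucᴰ tᴰ)) c ×ᴰ
               atᴰ (sucᴰ (castᴰ (λ x η → +-comm (N x) (Vec.head η)) (qᴰ 3 tᴰ))) d)))
      acceptingᴰ : Definable (suc k) {0} (λ x η g i → Accepting x g i)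
      acceptingᴰ = ◇ᴰ (qᴰ 4 (q₀ᴰ 1) ×ᴰ ¬ᴰ qᴰ 4 (qᴰ 2 (q₀ᴰ 2)) ×ᴰ
                       lastInᴰ (λ a → T? (acceptingCell (decode a))))

  module _ (x : Word) where

    3≤D : 3 ≤ D x
    3≤D = ≤-trans (n≤1+n 3) (^-monoʳ-≤ 2 (≤-trans (m≤n+m 2 c) (m≤n+m (c + 2) (length x ^ suc k))))

    n≤D : length x ≤ D x
    n≤D = ≤-trans (n≤n^1+k (length x))
      (≤-trans (m≤m+n _ (c + 2)) (<⇒≤ (n<2^n (m x))))
      where
      n≤n^1+k : ∀ n → n ≤ n ^ suc k
      n≤n^1+k zero    = z≤n
      n≤n^1+k (suc n) = ≤-trans (≤-reflexive (sym (*-identityʳ (suc n))))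
        (*-monoʳ-≤ (suc n) (m^n>0 (suc n) k))

    bound≤D : c * 2 ^ (length x ^ k) ≤ D x
    bound≤D = begin
      c * 2 ^ (n ^ k)             ≤⟨ *-mono-≤ (<⇒≤ (n<2^n c)) (^-monoʳ-≤ 2 n^k≤) ⟩
      2 ^ c * 2 ^ (n ^ suc k + 1) ≡⟨ sym (^-distribˡ-+-* 2 c (n ^ suc k + 1)) ⟩
      2 ^ (c + (n ^ suc k + 1))   ≤⟨ ^-monoʳ-≤ 2 (≤-trans (n≤1+n _) (≤-reflexive (regroup c (n ^ suc k)))) ⟩
      D x                         ∎
      where
      open ≤-Reasoning
      n = length x
      n^k≤ : n ^ k ≤ n ^ suc k + 1
      n^k≤ = subst (λ j → n ^ k ≤ n ^ j + 1) (+-comm k 1) (^-weaken n k 1)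
      regroup : ∀ c N → suc (c + (N + 1)) ≡ N + (c + 2)
      regroup = solve-∀

    D*N≡q₄ : D x * N x ≡ q 4 x
    D*N≡q₄ = regroup (D x)
      where
      regroup : ∀ P → P * (2 * (P * (P * (P * 1)))) ≡ 2 * (P * (P * (P * (P * 1))))
      regroup = solve-∀

    D≤q₁ : D x ≤ q 1 x
    D≤q₁ = ≤-trans (≤-reflexive (sym (*-identityʳ (D x)))) (m≤m+n (D x * 1) (D x * 1 + 0))

    private
      D*N+ : ∀ n → D x * N x + n ≡ q 4 x + n
      D*N+ n = cong (_+ n) D*N≡q₄

    open ShapeOf.Correctness x (D x) (2P≤ 3≤D) (2P²+2P< 3≤D) n≤D
      (≤-reflexive (trans D*N≡q₄ (sym (val-pw 4 x))))
      (subst (λ r → suc r + N x < q 5 x) (sym (val-pw 4 x)) (2P⁴+2P³< 3≤D))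
      (subst (_≤ q 4 x + q 1 x) (sym (D*N+ (D x))) (+-monoʳ-≤ (q 4 x) D≤q₁))
      (subst₂ _≤_ (sym (+-assoc (q 4 x) (q 2 x + q 2 x) (D x))) (sym (D*N+ (N x)))
        (+-monoʳ-≤ (q 4 x) (4P²+P≤ 3≤D)))
      (subst₂ _≤_ (sym (+-assoc (q 4 x) (q 1 x) (D x))) (sym (D*N+ (H x)))
        (+-monoʳ-≤ (q 4 x) (3P≤ 3≤D)))
      (subst (_< q 4 x + (q 2 x + q 2 x)) (sym (D*N+ (H x + D x))) (+-monoʳ-< (q 4 x) (2P²+P< 3≤D)))
      public using (tableau⇒accepts; accepts⇒tableau)

  root : Word → Succinct S 0
  root x = ⟨ A ⟩^ (const one) (formula tableauᴰ x)

  reduction : Word → MCInstance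
  reduction x = record
    { kripke  = graph
    ; formula = root x
    ; valid   = ℤ.+≤+ z≤n , valid tableauᴰ x []
    }

  reduction-PolyTime : PolyTime (λ x → encodeKripke graph ++ encodeSuccinct (root x))
  reduction-PolyTime = PolyTime-⟦⟧ (proj₁ computation) (proj₂ computation)
    where
    computation : Computable (suc k) (λ x → encodeKripke graph ++ encodeSuccinct (root x))
    computation = constᶜ (encodeKripke graph) ++ᶜ constᶜ _ ++ᶜ computable tableauᴰ

  models⇒accepts : ∀ x → Models graph (expand [] (root x)) → Accepts x
  models⇒accepts x models =
    -- Any initial track would do, since only the track guessed by `⟨ A ⟩` matters.
    let (ρ , _ , sat) = models (track (w ∷ w ∷ []) (s≤s (s≤s z≤n))) refl
        (g , i , ρ≡)  = enumerate ρ
    in tableau⇒accepts x {g} {i} (to (meaning tableauᴰ x [] g i ρ ρ≡) sat)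

  accepts⇒models : ∀ x → (∀ {n c′} → Steps _⟶_ n (initial x) c′ → n ≤ c * 2 ^ (length x ^ k)) →
                   Accepts x → Models graph (expand [] (root x))
  accepts⇒models x halts accepts ρ _ =
    let (v , last≡v)        = last-just (Track.path ρ) (Track.long ρ)
        (g , g₀≡v , tableau) = accepts⇒tableau x (λ r → ≤-trans (halts r) (bound≤D x)) accepts v
        (σ , σ≡)            = lists g (q 5 x)
    in σ , trans last≡v (sym (trans (cong List.head σ≡) (cong just g₀≡v))) ,
       from (meaning tableauᴰ x [] g (q 5 x) σ σ≡) tableau

theorem39 : NEXP-hard SuccinctModelChecking
theorem39 L (M , c , k , halts , L⇔) = reduction , reduction-PolyTime , λ x → mk⇔
  (accepts⇒models x (halts x) ∘ to (L⇔ x))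
  (from (L⇔ x) ∘ models⇒accepts x)
  where open Reduction M c k
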